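{- Let $F$ be a (fixed) graph with at least one edge and let $r=r(F)$. Then, for each fixed real number $p\in(0,1)$, with high probability, $$\mathrm{sat}\big(\mathbb{G}(n,p),F\big)\geqslant\frac{r-1}{2}n-\big(r-1+o(1)\big)\log_{\frac{1}{1-p}}n.$$
   Context: All graphs are finite, undirected, without loops or multiple edges. For a graph $F$, $r(F)=\min_{xy\in E(F)}\max\{d(x),d(y)\}$, where $d(x)$ is the degree of $x$ in $F$. For graphs $G$ and $F$, a graph is $F$-free if it has no subgraph (not necessarily induced) isomorphic to $F$. A spanning subgraph $H$ of $G$ is an $F$-saturated subgraph of $G$ if $H$ is $F$-free and adding any edge of $E(G)\setminus E(H)$ to $H$ creates a copy of $F$. $\mathrm{sat}(G,F)$ denotes the minimum number of edges in an $F$-saturated subgraph of $G$. $\mathbb{G}(n,p)$ is the Erdős–Rényi random graph on a fixed vertex set of size $n$, where every two distinct vertices are adjacent independently with probability $p$. "With high probability" means with probability tending to $1$ as $n\to\infty$. The term $o(1)$ denotes a function of $n$ (depending on the fixed $p$ and $F$) tending to $0$ as $n\to\infty$. -}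

module Defs where

open import Algebra.Bundles using (CommutativeRing; CommutativeSemiring)
open import Data.Bool using (Bool; true; false; T; if_then_else_)
open import Data.Bool.Properties using (T?)
open import Data.Empty using (⊥-elim)
open import Data.Fin using (Fin; zero; suc)
import Data.Fin as Fin
import Data.Fin.Properties as Finₚ
open import Data.Integer using (+_; +[1+_]; +≤+)
import Data.Integer as ℤ
import Data.Integer.Properties as ℤₚ
open import Data.List using (List; []; _∷_; length; map; filter; filterᵇ; foldr; allFin;
                             cartesianProduct; cartesianProductWith)
open import Data.List.Extrema.Nat using (min)
open import Data.Nat using (ℕ; zero; suc)
import Data.Nat as ℕ
import Data.Nat.Properties as ℕₚ
open import Data.Product using (Σ; ∃; ∃-syntax; _×_; _,_; proj₁; proj₂; uncurry)
open import Data.Rational using (ℚ; mkℚ; 0ℚ; 1ℚ; ½; _+_; _*_; _-_; -_; _≤_; _<_; ∣_∣; _⊔_; 1/_; _/_;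
                                 NonNegative; Positive; NonZero; nonNegative; positive; toℚᵘ; fromℚᵘ; *<*)
open import Data.Rational.Properties
import Data.Rational.Unnormalised as ℚᵘ
import Data.Rational.Unnormalised.Properties as ℚᵘₚ
open import Data.Rational.Solver using (module +-*-Solver)
open import Data.Sum using (_⊎_; inj₁; inj₂)
open import Data.Vec using (Vec; []; _∷_; lookup; tabulate; _[_]≔_)
open import Data.Vec.Properties using (lookup∘tabulate)
open import Function using (_∘_; case_of_)
open import Function.Definitions using (Injective)
open import Relation.Binary.PropositionalEquality
open import Relation.Nullary using (Dec; yes; no; ¬_; contradiction)
open import Relation.Nullary.Decidable using (map′; ¬?; _×-dec_; _→-dec_)

open +-*-Solver
open CommutativeRing +-*-commutativeRing using (commutativeSemiring)
open import Algebra.Properties.CommutativeSemiring.Exp commutativeSemiring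
  using (_^_; ^-assocʳ)

------------------------------------------------------------------------
-- Real numbers, as Cauchy sequences of rationals

Eventually : (ℕ → Set) → Set
Eventually P = ∃[ N ] ∀ n → N ℕ.≤ n → P n

Eventually-map : ∀ {P Q : ℕ → Set} → (∀ {n} → P n → Q n) → Eventually P → Eventually Q
Eventually-map f (N , h) = N , λ n N≤n → f (h n N≤n)

Eventually-zip : ∀ {P Q R : ℕ → Set} → (∀ {n} → P n → Q n → R n) →
                 Eventually P → Eventually Q → Eventually R
Eventually-zip f (M , g) (N , h) =
  M ℕ.⊔ N , λ n le → f (g n (ℕₚ.m⊔n≤o⇒m≤o M N le)) (h n (ℕₚ.m⊔n≤o⇒n≤o M N le))

IsCauchy : (ℕ → ℚ) → Set
IsCauchy u = ∀ ε → 0ℚ < ε → ∃[ N ] ∀ m n → N ℕ.≤ m → N ℕ.≤ n → ∣ u m - u n ∣ ≤ ε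

record ℝ : Set where
  constructor mkℝ
  field
    seq    : ℕ → ℚ
    cauchy : IsCauchy seq

open ℝ public

infix 4 _<ℝ_ _≤ℝ_ _≥ℝ_

_<ℝ_ _≤ℝ_ _≥ℝ_ : ℝ → ℝ → Set
x <ℝ y = ∃[ ε ] 0ℚ < ε × Eventually (λ n → seq x n + ε ≤ seq y n)
x ≤ℝ y = ∀ ε → 0ℚ < ε → Eventually (λ n → seq x n ≤ seq y n + ε)
x ≥ℝ y = y ≤ℝ x

module CauchyLemmas where
  abs-≤ : ∀ {p q} → p ≤ q → - p ≤ q → ∣ p ∣ ≤ q
  abs-≤ {p} h h′ with ∣p∣≡p∨∣p∣≡-p p
  ... | inj₁ eq = ≤-trans (≤-reflexive eq) h
  ... | inj₂ eq = ≤-trans (≤-reflexive eq) h′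

  p≤∣p∣ : ∀ p → p ≤ ∣ p ∣
  p≤∣p∣ p with ≤-total 0ℚ p
  ... | inj₁ 0≤p = ≤-reflexive (sym (0≤p⇒∣p∣≡p 0≤p))
  ... | inj₂ p≤0 = ≤-trans p≤0 (0≤∣p∣ p)

  half+half : ∀ ε → ½ * ε + ½ * ε ≡ ε
  half+half ε = trans (sym (*-distribʳ-+ ε ½ ½)) (*-identityˡ ε)

  *-pos : ∀ {p q} → 0ℚ < p → 0ℚ < q → 0ℚ < p * q
  *-pos {p} {q} 0<p 0<q =
    positive⁻¹ (p * q) {{pos*pos⇒pos p {{positive 0<p}} q {{positive 0<q}}}}

  *-nonNeg : ∀ {p q} → 0ℚ ≤ p → 0ℚ ≤ q → 0ℚ ≤ p * q
  *-nonNeg {p} {q} 0≤p 0≤q =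
    nonNegative⁻¹ (p * q) {{nonNeg*nonNeg⇒nonNeg p {{nonNegative 0≤p}} q {{nonNegative 0≤q}}}}

  *-mono : ∀ {p q r s} → 0ℚ ≤ p → p ≤ q → 0ℚ ≤ r → r ≤ s → p * r ≤ q * s
  *-mono {p} {q} {r} {s} 0≤p p≤q 0≤r r≤s =
    ≤-trans (*-monoʳ-≤-nonNeg r {{nonNegative 0≤r}} p≤q)
            (*-monoˡ-≤-nonNeg q {{nonNegative (≤-trans 0≤p p≤q)}} r≤s)

  0<½ : 0ℚ < ½
  0<½ = positive⁻¹ ½

  0<1 : 0ℚ < 1ℚ
  0<1 = positive⁻¹ 1ℚ

  inv : ∀ q → 0ℚ < q → ℚ
  inv q 0<q = (1/ q) {{pos⇒nonZero q {{positive 0<q}}}}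

  inv-inverseˡ : ∀ q (0<q : 0ℚ < q) → inv q 0<q * q ≡ 1ℚ
  inv-inverseˡ q 0<q = *-inverseˡ q {{pos⇒nonZero q {{positive 0<q}}}}

  inv-pos : ∀ q (0<q : 0ℚ < q) → 0ℚ < inv q 0<q
  inv-pos q 0<q = positive⁻¹ (inv q 0<q) {{1/pos⇒pos q {{positive 0<q}}}}

  inv-cancel : ∀ q (0<q : 0ℚ < q) p → p * inv q 0<q * q ≡ p
  inv-cancel q 0<q p = trans (*-assoc p (inv q 0<q) q)
    (trans (cong (p *_) (inv-inverseˡ q 0<q)) (*-identityʳ p))

  const-cauchy : ∀ q → IsCauchy (λ _ → q)
  const-cauchy q ε 0<ε = 0 , λ _ _ _ _ →
    ≤-trans (≤-reflexive (cong ∣_∣ (+-inverseʳ q))) (<⇒≤ 0<ε)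

  +-cauchy : ∀ {u v} → IsCauchy u → IsCauchy v → IsCauchy (λ n → u n + v n)
  +-cauchy {u} {v} cu cv ε 0<ε with cu (½ * ε) (*-pos 0<½ 0<ε) | cv (½ * ε) (*-pos 0<½ 0<ε)
  ... | M , g | N , h = M ℕ.⊔ N , λ m n le le′ →
    ≤-trans (≤-reflexive (cong ∣_∣ (rearrange (u m) (v m) (u n) (v n))))
    (≤-trans (∣p+q∣≤∣p∣+∣q∣ (u m - u n) (v m - v n))
    (≤-trans (+-mono-≤ (g m n (ℕₚ.m⊔n≤o⇒m≤o M N le) (ℕₚ.m⊔n≤o⇒m≤o M N le′))
                       (h m n (ℕₚ.m⊔n≤o⇒n≤o M N le) (ℕₚ.m⊔n≤o⇒n≤o M N le′)))
             (≤-reflexive (half+half ε))))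
    where
    rearrange : ∀ a b c d → (a + b) - (c + d) ≡ (a - c) + (b - d)
    rearrange = solve 4 (λ a b c d → (a :+ b) :- (c :+ d) := (a :- c) :+ (b :- d)) refl

  neg-cauchy : ∀ {u} → IsCauchy u → IsCauchy (λ n → - u n)
  neg-cauchy {u} cu ε 0<ε with cu ε 0<ε
  ... | N , h = N , λ m n le le′ →
    ≤-trans (≤-reflexive (trans (cong ∣_∣ (sym (neg-distrib-+ (u m) (- u n)))) (∣-p∣≡∣p∣ (u m - u n))))
            (h m n le le′)

  bounded : ∀ {u} → IsCauchy u → ∃[ K ] 0ℚ < K × Eventually (λ n → ∣ u n ∣ ≤ K)
  bounded {u} cu with cu 1ℚ 0<1
  ... | N , h = 1ℚ + ∣ u N ∣
              , <-≤-trans 0<1 (≤-trans (≤-reflexive (sym (+-identityʳ 1ℚ))) (+-monoʳ-≤ 1ℚ (0≤∣p∣ (u N))))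
              , N , λ n N≤n →
    ≤-trans (≤-reflexive (cong ∣_∣ (rearrange (u n) (u N))))
    (≤-trans (∣p+q∣≤∣p∣+∣q∣ (u n - u N) (u N))
             (+-monoˡ-≤ ∣ u N ∣ (h n N N≤n ℕₚ.≤-refl)))
    where
    rearrange : ∀ a b → a ≡ (a - b) + b
    rearrange = solve 2 (λ a b → a := (a :- b) :+ b) refl

  *-cauchy : ∀ {u v} → IsCauchy u → IsCauchy v → IsCauchy (λ n → u n * v n)
  *-cauchy {u} {v} cu cv ε 0<ε = go (bounded {u} cu) (bounded {v} cv)
    where
    go : ∃[ K ] 0ℚ < K × Eventually (λ n → ∣ u n ∣ ≤ K) →
         ∃[ L ] 0ℚ < L × Eventually (λ n → ∣ v n ∣ ≤ L) →
         ∃[ N ] ∀ m n → N ℕ.≤ m → N ℕ.≤ n → ∣ u m * v m - u n * v n ∣ ≤ ε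
    go (K , 0<K , A , bu) (L , 0<L , B , bv) = R , est
      where
      δ η : ℚ
      δ = ½ * ε * inv L 0<L
      η = ½ * ε * inv K 0<K
      0<δ : 0ℚ < δ
      0<δ = *-pos (*-pos 0<½ 0<ε) (inv-pos L 0<L)
      0<η : 0ℚ < η
      0<η = *-pos (*-pos 0<½ 0<ε) (inv-pos K 0<K)
      M N R : ℕ
      M = proj₁ (cu δ 0<δ)
      N = proj₁ (cv η 0<η)
      R = (A ℕ.⊔ B) ℕ.⊔ (M ℕ.⊔ N)
      A≤ : ∀ {n} → R ℕ.≤ n → A ℕ.≤ n
      A≤ = ℕₚ.≤-trans (ℕₚ.≤-trans (ℕₚ.m≤m⊔n A B) (ℕₚ.m≤m⊔n _ _))
      B≤ : ∀ {n} → R ℕ.≤ n → B ℕ.≤ n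
      B≤ = ℕₚ.≤-trans (ℕₚ.≤-trans (ℕₚ.m≤n⊔m A B) (ℕₚ.m≤m⊔n _ _))
      M≤ : ∀ {n} → R ℕ.≤ n → M ℕ.≤ n
      M≤ = ℕₚ.≤-trans (ℕₚ.≤-trans (ℕₚ.m≤m⊔n M N) (ℕₚ.m≤n⊔m (A ℕ.⊔ B) _))
      N≤ : ∀ {n} → R ℕ.≤ n → N ℕ.≤ n
      N≤ = ℕₚ.≤-trans (ℕₚ.≤-trans (ℕₚ.m≤n⊔m M N) (ℕₚ.m≤n⊔m (A ℕ.⊔ B) _))
      rearrange : ∀ a b c d → a * b - c * d ≡ a * (b - d) + (a - c) * d
      rearrange = solve 4 (λ a b c d → a :* b :- c :* d := a :* (b :- d) :+ (a :- c) :* d) refl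
      sumup : K * η + δ * L ≡ ε
      sumup = trans (cong₂ _+_ (trans (*-comm K η) (inv-cancel K 0<K (½ * ε)))
                               (inv-cancel L 0<L (½ * ε)))
                    (half+half ε)
      est : ∀ m n → R ℕ.≤ m → R ℕ.≤ n → ∣ u m * v m - u n * v n ∣ ≤ ε
      est m n le le′ =
        ≤-trans (≤-reflexive (cong ∣_∣ (rearrange (u m) (v m) (u n) (v n))))
        (≤-trans (∣p+q∣≤∣p∣+∣q∣ (u m * (v m - v n)) ((u m - u n) * v n))
        (≤-trans (≤-reflexive (cong₂ _+_ (∣p*q∣≡∣p∣*∣q∣ (u m) (v m - v n)) (∣p*q∣≡∣p∣*∣q∣ (u m - u n) (v n))))
        (≤-trans (+-mono-≤
          (*-mono (0≤∣p∣ (u m)) (bu m (A≤ le)) (0≤∣p∣ _) (proj₂ (cv η 0<η) m n (N≤ le) (N≤ le′)))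
          (*-mono (0≤∣p∣ _) (proj₂ (cu δ 0<δ) m n (M≤ le) (M≤ le′)) (0≤∣p∣ (v n)) (bv n (B≤ le′))))
        (≤-reflexive sumup))))

open CauchyLemmas

fromℚ : ℚ → ℝ
fromℚ q = mkℝ (λ _ → q) (const-cauchy q)

fromℕ : ℕ → ℝ
fromℕ n = fromℚ (+ n / 1)

0ℝ 1ℝ : ℝ
0ℝ = fromℚ 0ℚ
1ℝ = fromℚ 1ℚ

infixl 6 _+ℝ_ _-ℝ_
infixl 7 _*ℝ_

_+ℝ_ _-ℝ_ _*ℝ_ : ℝ → ℝ → ℝ
x +ℝ y = mkℝ (λ n → seq x n + seq y n) (+-cauchy {seq x} {seq y} (cauchy x) (cauchy y))
x -ℝ y = mkℝ (λ n → seq x n - seq y n) (+-cauchy {seq x} { -_ ∘ seq y} (cauchy x) (neg-cauchy {seq y} (cauchy y)))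
x *ℝ y = mkℝ (λ n → seq x n * seq y n) (*-cauchy {seq x} {seq y} (cauchy x) (cauchy y))

∑ ∏ : List ℝ → ℝ
∑ = foldr _+ℝ_ 0ℝ
∏ = foldr _*ℝ_ 1ℝ

infix 4 _⟶_

_⟶_ : (ℕ → ℝ) → ℝ → Set
u ⟶ x = ∀ ε → 0ℝ <ℝ ε → Eventually λ n → (u n ≤ℝ x +ℝ ε) × (x ≤ℝ u n +ℝ ε)

------------------------------------------------------------------------
-- Reciprocal of a positive real

module Reciprocal (ε : ℚ) (0<ε : 0ℚ < ε) where
  trunc-pos : ∀ q → 0ℚ < ε ⊔ q
  trunc-pos q = <-≤-trans 0<ε (p≤p⊔q ε q)

  recip : ℚ → ℚ
  recip q = inv (ε ⊔ q) (trunc-pos q)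

  1/ε : ℚ
  1/ε = inv ε 0<ε

  recip-inverse : ∀ q → recip q * (ε ⊔ q) ≡ 1ℚ
  recip-inverse q = inv-inverseˡ (ε ⊔ q) (trunc-pos q)

  recip-nonNeg : ∀ q → 0ℚ ≤ recip q
  recip-nonNeg q = <⇒≤ (inv-pos (ε ⊔ q) (trunc-pos q))

  ε*1/ε : ε * 1/ε ≡ 1ℚ
  ε*1/ε = trans (*-comm ε 1/ε) (inv-inverseˡ ε 0<ε)

  recip-bound : ∀ q → recip q ≤ 1/ε
  recip-bound q =
    ≤-trans (≤-reflexive (trans (sym (*-identityʳ (recip q))) (cong (recip q *_) (sym ε*1/ε))))
    (≤-trans (*-mono (recip-nonNeg q) ≤-refl (*-nonNeg (<⇒≤ 0<ε) (<⇒≤ (inv-pos ε 0<ε)))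
               (*-mono (<⇒≤ 0<ε) (p≤p⊔q ε q) (<⇒≤ (inv-pos ε 0<ε)) ≤-refl))
    (≤-reflexive (trans (sym (*-assoc (recip q) (ε ⊔ q) 1/ε))
      (trans (cong (_* 1/ε) (recip-inverse q)) (*-identityˡ 1/ε)))))

  recip-diff : ∀ p q → recip p - recip q ≡ ((ε ⊔ q) - (ε ⊔ p)) * (recip p * recip q)
  recip-diff p q = trans
    (cong₂ _-_ (trans (sym (*-identityʳ (recip p))) (cong (recip p *_) (sym (recip-inverse q))))
               (trans (sym (*-identityʳ (recip q))) (cong (recip q *_) (sym (recip-inverse p)))))
    (rearrange (recip p) (recip q) (ε ⊔ p) (ε ⊔ q))
    where
    rearrange : ∀ a b c d → a * (b * d) - b * (a * c) ≡ (d - c) * (a * b)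
    rearrange = solve 4 (λ a b c d → a :* (b :* d) :- b :* (a :* c) := (d :- c) :* (a :* b)) refl

  recip-cauchy : ∀ {u} → IsCauchy u → Eventually (λ n → ε ≤ u n) → IsCauchy (recip ∘ u)
  recip-cauchy {u} cu (A , big) ζ 0<ζ with cu (ζ * (ε * ε)) (*-pos 0<ζ (*-pos 0<ε 0<ε))
  ... | N , h = A ℕ.⊔ N , λ m n le le′ →
    ≤-trans (≤-reflexive (trans (cong ∣_∣ (recip-diff (u m) (u n)))
              (trans (cong₂ (λ a b → ∣ (a - b) * (recip (u m) * recip (u n)) ∣) (untrunc n le′) (untrunc m le))
                     (∣p*q∣≡∣p∣*∣q∣ (u n - u m) (recip (u m) * recip (u n))))))
    (≤-trans (*-mono (0≤∣p∣ _) (h n m (N≤ le′) (N≤ le)) (0≤∣p∣ _)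
               (≤-trans (≤-reflexive (0≤p⇒∣p∣≡p (*-nonNeg (recip-nonNeg (u m)) (recip-nonNeg (u n)))))
                        (*-mono (recip-nonNeg (u m)) (recip-bound (u m)) (recip-nonNeg (u n)) (recip-bound (u n)))))
    (≤-reflexive (trans (rearrange ζ ε 1/ε)
      (trans (cong₂ (λ a b → ζ * (a * b)) ε*1/ε ε*1/ε) (*-identityʳ ζ)))))
    where
    N≤ : ∀ {n} → A ℕ.⊔ N ℕ.≤ n → N ℕ.≤ n
    N≤ = ℕₚ.≤-trans (ℕₚ.m≤n⊔m A N)
    untrunc : ∀ n → A ℕ.⊔ N ℕ.≤ n → ε ⊔ u n ≡ u n
    untrunc n le = p≤q⇒p⊔q≡q (big n (ℕₚ.m⊔n≤o⇒m≤o A N le))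
    rearrange : ∀ z e f → (z * (e * e)) * (f * f) ≡ z * ((e * f) * (e * f))
    rearrange = solve 3 (λ z e f → (z :* (e :* e)) :* (f :* f) := z :* ((e :* f) :* (e :* f))) refl

-- The terms of x are truncated below at a rational ε with 0 < ε ≤ x; this
-- changes only finitely many of them.
1/ℝ : (x : ℝ) → 0ℝ <ℝ x → ℝ
1/ℝ x (ε , 0<ε , ε≤x) = mkℝ (Reciprocal.recip ε 0<ε ∘ seq x)
  (Reciprocal.recip-cauchy ε 0<ε {seq x} (cauchy x)
    (Eventually-map (≤-trans (≤-reflexive (sym (+-identityˡ ε)))) ε≤x))

x<1⇒0<1-x : ∀ {x} → x <ℝ 1ℝ → 0ℝ <ℝ 1ℝ -ℝ x
x<1⇒0<1-x {x} (ε , 0<ε , h) = ε , 0<ε , Eventually-map (λ {n} → step {seq x n}) h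
  where
  rearrange : ∀ a e → (a + e) - a ≡ 0ℚ + e
  rearrange = solve 2 (λ a e → (a :+ e) :- a := con 0ℚ :+ e) refl
  step : ∀ {a} → a + ε ≤ 1ℚ → 0ℚ + ε ≤ 1ℚ - a
  step {a} le = ≤-trans (≤-reflexive (sym (rearrange a ε))) (+-monoˡ-≤ (- a) le)

1<1/[1-x] : ∀ {x} → 0ℝ <ℝ x → (x<1 : x <ℝ 1ℝ) → 1ℝ <ℝ 1/ℝ (1ℝ -ℝ x) (x<1⇒0<1-x {x} x<1)
1<1/[1-x] {x} (δ , 0<δ , g) (ε , 0<ε , h) =
  δ , 0<δ , Eventually-zip (λ {n} → step (seq x n)) g (proj₂ (proj₂ (x<1⇒0<1-x {x} (ε , 0<ε , h))))
  where
  open Reciprocal ε 0<ε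
  rearrange : ∀ r a → r ≡ r * (1ℚ - a) + r * a
  rearrange = solve 2 (λ r a → r := r :* (con 1ℚ :- a) :+ r :* a) refl
  step : ∀ a → 0ℚ + δ ≤ a → 0ℚ + ε ≤ 1ℚ - a → 1ℚ + δ ≤ recip (1ℚ - a)
  step a δ≤a ε≤ = ≤-trans (+-monoʳ-≤ 1ℚ δ≤ra) (≤-reflexive (sym split))
    where
    r : ℚ
    r = recip (1ℚ - a)
    inverse : r * (1ℚ - a) ≡ 1ℚ
    inverse = trans (cong (r *_) (sym (p≤q⇒p⊔q≡q (≤-trans (≤-reflexive (sym (+-identityˡ ε))) ε≤))))
                    (recip-inverse (1ℚ - a))
    split : r ≡ 1ℚ + r * a
    split = trans (rearrange r a) (cong (_+ r * a) inverse)
    δ≤a′ : δ ≤ a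
    δ≤a′ = ≤-trans (≤-reflexive (sym (+-identityˡ δ))) δ≤a
    0≤a : 0ℚ ≤ a
    0≤a = ≤-trans (<⇒≤ 0<δ) δ≤a′
    1≤r : 1ℚ ≤ r
    1≤r = ≤-trans (≤-reflexive (sym (+-identityʳ 1ℚ)))
          (≤-trans (+-monoʳ-≤ 1ℚ (*-nonNeg (recip-nonNeg (1ℚ - a)) 0≤a)) (≤-reflexive (sym split)))
    δ≤ra : δ ≤ r * a
    δ≤ra = ≤-trans (≤-reflexive (sym (*-identityˡ δ))) (*-mono (<⇒≤ 0<1) 1≤r (<⇒≤ 0<δ) δ≤a′)

------------------------------------------------------------------------
-- Logarithms of positive integers to a real base greater than 1

Lower Upper : ℝ → ℕ → ℕ → ℕ → Set
Lower b n k m = Eventually λ i → seq b i ^ m ≤ (+ n / 1) ^ k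
Upper b n k m = Eventually λ i → (+ n / 1) ^ k ≤ seq b i ^ m

module LogLemmas where
  /-≤ : ∀ m a m′ a′ → m ℕ.* suc a′ ℕ.≤ m′ ℕ.* suc a → + m / suc a ≤ + m′ / suc a′
  /-≤ m a m′ a′ le = toℚᵘ-cancel-≤
    (ℚᵘₚ.≤-respʳ-≃ (ℚᵘₚ.≃-sym (toℚᵘ-fromℚᵘ (ℚᵘ.mkℚᵘ (+ m′) a′)))
    (ℚᵘₚ.≤-respˡ-≃ (ℚᵘₚ.≃-sym (toℚᵘ-fromℚᵘ (ℚᵘ.mkℚᵘ (+ m) a)))
    (ℚᵘ.*≤* (subst₂ ℤ._≤_ (ℤₚ.pos-* m (suc a′)) (ℤₚ.pos-* m′ (suc a)) (+≤+ le)))))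

  /-+ : ∀ m m′ a → + (m ℕ.+ m′) / suc a ≡ + m / suc a + + m′ / suc a
  /-+ m m′ a = toℚᵘ-injective
    (ℚᵘₚ.≃-trans (toℚᵘ-fromℚᵘ (ℚᵘ.mkℚᵘ (+ (m ℕ.+ m′)) a))
    (ℚᵘₚ.≃-trans eq
    (ℚᵘₚ.≃-sym (ℚᵘₚ.≃-trans (toℚᵘ-homo-+ (+ m / suc a) (+ m′ / suc a))
      (ℚᵘₚ.+-cong (toℚᵘ-fromℚᵘ (ℚᵘ.mkℚᵘ (+ m) a)) (toℚᵘ-fromℚᵘ (ℚᵘ.mkℚᵘ (+ m′) a)))))))
    where
    d : ℤ.ℤ
    d = + suc a
    eq : ℚᵘ.mkℚᵘ (+ (m ℕ.+ m′)) a ℚᵘ.≃ ℚᵘ.mkℚᵘ (+ m) a ℚᵘ.+ ℚᵘ.mkℚᵘ (+ m′) a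
    eq = ℚᵘ.*≡* (trans (sym (ℤₚ.*-assoc (+ (m ℕ.+ m′)) d d))
      (cong (ℤ._* d) (trans (cong (ℤ._* d) (ℤₚ.pos-+ m m′)) (ℤₚ.*-distribʳ-+ d (+ m) (+ m′)))))

  archimedean : ∀ q → ∃[ m ] q ≤ + m / 1
  archimedean q@(mkℚ i d-1 _) = ℤ.∣ i ∣ , toℚᵘ-cancel-≤
    (ℚᵘₚ.≤-respʳ-≃ (ℚᵘₚ.≃-sym (toℚᵘ-fromℚᵘ (ℚᵘ.mkℚᵘ (+ ℤ.∣ i ∣) 0)))
    (ℚᵘ.*≤* (ℤₚ.≤-trans (ℤₚ.≤-reflexive (ℤₚ.*-identityʳ i)) (ℤₚ.≤-trans (i≤∣i∣ i)
      (subst (+ ℤ.∣ i ∣ ℤ.≤_) (ℤₚ.pos-* ℤ.∣ i ∣ (suc d-1)) (+≤+ (ℕₚ.m≤m*n ℤ.∣ i ∣ (suc d-1))))))))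
    where
    i≤∣i∣ : ∀ j → j ℤ.≤ + ℤ.∣ j ∣
    i≤∣i∣ (+ _) = ℤₚ.≤-refl
    i≤∣i∣ (ℤ.-[1+ _ ]) = ℤ.-≤+

  2/-small : ∀ ε → 0ℚ < ε → Eventually λ j → + 2 / suc j ≤ ε
  2/-small (mkℚ (+ 0) _ _) (*<* (ℤ.+<+ ()))
  2/-small (mkℚ (ℤ.-[1+ _ ]) _ _) (*<* ())
  2/-small ε@(mkℚ +[1+ a ] d _) _ = 2 ℕ.* suc d , λ j le →
    ≤-trans (/-≤ 2 j (suc a) d (ℕₚ.≤-trans le (ℕₚ.≤-trans (ℕₚ.n≤1+n j) (ℕₚ.m≤n*m (suc j) (suc a)))))
            (≤-reflexive (↥p/↧p≡p ε))

  pow-cauchy : ∀ {u} → IsCauchy u → ∀ m → IsCauchy (λ i → u i ^ m)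
  pow-cauchy     cu zero    = const-cauchy 1ℚ
  pow-cauchy {u} cu (suc m) = *-cauchy {u} {λ i → u i ^ m} cu (pow-cauchy {u} cu m)

  pow-nonNeg : ∀ {a} → 0ℚ ≤ a → ∀ m → 0ℚ ≤ a ^ m
  pow-nonNeg 0≤a zero    = <⇒≤ 0<1
  pow-nonNeg 0≤a (suc m) = *-nonNeg 0≤a (pow-nonNeg 0≤a m)

  pow-mono : ∀ {a c} → 0ℚ ≤ a → a ≤ c → ∀ m → a ^ m ≤ c ^ m
  pow-mono 0≤a a≤c zero    = ≤-refl
  pow-mono 0≤a a≤c (suc m) = *-mono 0≤a a≤c (pow-nonNeg 0≤a m) (pow-mono 0≤a a≤c m)

  1≤pow : ∀ {a} → 1ℚ ≤ a → ∀ m → 1ℚ ≤ a ^ m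
  1≤pow 1≤a zero    = ≤-refl
  1≤pow 1≤a (suc m) = *-mono (<⇒≤ 0<1) 1≤a (<⇒≤ 0<1) (1≤pow 1≤a m)

  1≤+n : ∀ n → 1ℚ ≤ + suc n / 1
  1≤+n n = /-≤ 1 0 (suc n) 0 (ℕ.s≤s ℕ.z≤n)

  module Base (δ : ℚ) (0<δ : 0ℚ < δ) where
    module _ {β : ℚ} (1+δ≤β : 1ℚ + δ ≤ β) where
      1≤β : 1ℚ ≤ β
      1≤β = ≤-trans (≤-trans (≤-reflexive (sym (+-identityʳ 1ℚ))) (+-monoʳ-≤ 1ℚ (<⇒≤ 0<δ))) 1+δ≤β

      0≤β : 0ℚ ≤ β
      0≤β = ≤-trans (<⇒≤ 0<1) 1≤β

      pow-step : ∀ m → β ^ m + δ ≤ β ^ suc m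
      pow-step m = ≤-trans (+-monoʳ-≤ (β ^ m) δ≤)
        (≤-trans (≤-reflexive (sym (rearrange δ (β ^ m))))
                 (*-monoʳ-≤-nonNeg (β ^ m) {{nonNegative (pow-nonNeg 0≤β m)}} 1+δ≤β))
        where
        rearrange : ∀ d x → (1ℚ + d) * x ≡ x + d * x
        rearrange = solve 2 (λ d x → (con 1ℚ :+ d) :* x := x :+ d :* x) refl
        δ≤ : δ ≤ δ * β ^ m
        δ≤ = ≤-trans (≤-reflexive (sym (*-identityʳ δ)))
                     (*-mono (<⇒≤ 0<δ) ≤-refl (<⇒≤ 0<1) (1≤pow 1≤β m))

      pow-< : ∀ m → β ^ m < β ^ suc m
      pow-< m = <-≤-trans (≤-<-trans (≤-reflexive (sym (+-identityʳ (β ^ m)))) (+-monoʳ-< (β ^ m) 0<δ))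
                          (pow-step m)

      pow-≤-+ : ∀ m d → β ^ m ≤ β ^ (d ℕ.+ m)
      pow-≤-+ m zero    = ≤-refl
      pow-≤-+ m (suc d) = ≤-trans (pow-≤-+ m d) (<⇒≤ (pow-< (d ℕ.+ m)))

      pow-reflects-≤ : ∀ m m′ → β ^ m ≤ β ^ m′ → m ℕ.≤ m′
      pow-reflects-≤ m m′ le with ℕₚ.≤-<-connex m m′
      ... | inj₁ m≤m′ = m≤m′
      ... | inj₂ m′<m = ⊥-elim (<-irrefl refl (<-≤-trans (pow-< m′) (≤-trans
              (subst (λ e → β ^ suc m′ ≤ β ^ e) (ℕₚ.m∸n+n≡m m′<m) (pow-≤-+ (suc m′) (m ℕ.∸ suc m′))) le)))

      pow-linear : ∀ m → (+ m / 1) * δ ≤ β ^ m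
      pow-linear zero    = ≤-trans (≤-reflexive (*-zeroˡ δ)) (<⇒≤ 0<1)
      pow-linear (suc m) = ≤-trans (≤-reflexive (trans (cong (_* δ) (/-+ 1 m 0)) (rearrange (+ m / 1) δ)))
        (≤-trans (+-monoˡ-≤ δ (pow-linear m)) (pow-step m))
        where
        rearrange : ∀ a d → (1ℚ + a) * d ≡ a * d + d
        rearrange = solve 2 (λ a d → (con 1ℚ :+ a) :* d := a :* d :+ d) refl

  decide : ∀ b → 1ℝ <ℝ b → ∀ n k m → Lower b n k m ⊎ Upper b n k (suc m)
  decide b (δ , 0<δ , A , big) n k m = case X ≤? seq b i ^ m + ½ * δ of λ where
      (yes X≤) → inj₂ (i , λ j le → ≤-trans X≤
        (≤-trans (+-monoˡ-≤ (½ * δ) (within i j ℕₚ.≤-refl le))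
        (≤-trans (≤-reflexive (trans (+-assoc (seq b j ^ m) (½ * δ) (½ * δ))
                                     (cong (λ z → seq b j ^ m + z) (half+half δ))))
                 (Base.pow-step δ 0<δ (big j (A≤ le)) m))))
      (no X≰) → inj₁ (i , λ j le → ≤-trans (within j i le ℕₚ.≤-refl) (<⇒≤ (≰⇒> X≰)))
    where
    modulus : ∃[ N ] ∀ j l → N ℕ.≤ j → N ℕ.≤ l → ∣ seq b j ^ m - seq b l ^ m ∣ ≤ ½ * δ
    modulus = pow-cauchy {seq b} (cauchy b) m (½ * δ) (*-pos 0<½ 0<δ)
    N : ℕ
    N = proj₁ modulus
    X : ℚ
    X = (+ n / 1) ^ k
    i : ℕ
    i = A ℕ.⊔ N
    A≤ : ∀ {j} → i ℕ.≤ j → A ℕ.≤ j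
    A≤ = ℕₚ.≤-trans (ℕₚ.m≤m⊔n A N)
    N≤ : ∀ {j} → i ℕ.≤ j → N ℕ.≤ j
    N≤ = ℕₚ.≤-trans (ℕₚ.m≤n⊔m A N)
    rearrange : ∀ a c → a ≡ c + (a - c)
    rearrange = solve 2 (λ a c → a := c :+ (a :- c)) refl
    within : ∀ j l → i ℕ.≤ j → i ℕ.≤ l → seq b j ^ m ≤ seq b l ^ m + ½ * δ
    within j l le le′ = ≤-trans (≤-reflexive (rearrange (seq b j ^ m) (seq b l ^ m)))
      (+-monoʳ-≤ (seq b l ^ m) (≤-trans (p≤∣p∣ (seq b j ^ m - seq b l ^ m)) (proj₂ modulus j l (N≤ le) (N≤ le′))))

  search : ∀ b → 1ℝ <ℝ b → ∀ n k f m → Lower b n k m → Upper b n k (2 ℕ.+ (f ℕ.+ m)) →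
           ∃[ m′ ] Lower b n k m′ × Upper b n k (2 ℕ.+ m′)
  search b 1<b n k zero    m lo up = m , lo , up
  search b 1<b n k (suc f) m lo up = case decide b 1<b n k (suc m) of λ where
    (inj₂ up′) → m , lo , up′
    (inj₁ lo′) → search b 1<b n k f (suc m) lo′
                   (subst (λ e → Upper b n k (2 ℕ.+ e)) (sym (ℕₚ.+-suc f m)) up)

open LogLemmas

bracket : ∀ b → 1ℝ <ℝ b → ∀ n k → ∃[ m ] Lower b (suc n) k m × Upper b (suc n) k (2 ℕ.+ m)
bracket b 1<b@(δ , 0<δ , big) n k = search b 1<b (suc n) k f 0
  (0 , λ _ _ → 1≤pow (1≤+n n) k)
  (Eventually-map (λ {i} 1+δ≤ → ≤-trans X≤fδ (≤-trans (Base.pow-linear δ 0<δ 1+δ≤ f)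
     (subst (λ e → seq b i ^ f ≤ seq b i ^ (2 ℕ.+ e)) (sym (ℕₚ.+-identityʳ f))
            (Base.pow-≤-+ δ 0<δ 1+δ≤ f 2)))) big)
  where
  X : ℚ
  X = (+ suc n / 1) ^ k
  f : ℕ
  f = proj₁ (archimedean (X * inv δ 0<δ))
  X≤fδ : X ≤ (+ f / 1) * δ
  X≤fδ = ≤-trans (≤-reflexive (sym (inv-cancel δ 0<δ X)))
                 (*-monoʳ-≤-nonNeg δ {{nonNegative (<⇒≤ 0<δ)}} (proj₂ (archimedean (X * inv δ 0<δ))))

module Log (b : ℝ) (1<b : 1ℝ <ℝ b) (n : ℕ) where
  num : ℕ → ℕ
  num j = proj₁ (bracket b 1<b n (suc j))

  compare : ∀ i j → num i ℕ.* suc j ℕ.≤ (num j ℕ.+ 2) ℕ.* suc i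
  compare i j =
    let 0≤X = ≤-trans (<⇒≤ 0<1) (1≤+n n)
        N , h = Eventually-zip _,_ (proj₂ (proj₂ 1<b))
                  (Eventually-zip _,_ (proj₁ (proj₂ (bracket b 1<b n (suc i))))
                                      (proj₂ (proj₂ (bracket b 1<b n (suc j)))))
        big , lo , up = h N ℕₚ.≤-refl
        β = seq b N
        X = + suc n / 1
        0≤β = Base.0≤β (proj₁ 1<b) (proj₁ (proj₂ 1<b)) big
        comm = trans (^-assocʳ X (suc i) (suc j))
                 (trans (cong (X ^_) (ℕₚ.*-comm (suc i) (suc j))) (sym (^-assocʳ X (suc j) (suc i))))
    in subst (λ e → num i ℕ.* suc j ℕ.≤ e ℕ.* suc i) (ℕₚ.+-comm 2 (num j))
       (Base.pow-reflects-≤ (proj₁ 1<b) (proj₁ (proj₂ 1<b)) big (num i ℕ.* suc j) ((2 ℕ.+ num j) ℕ.* suc i)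
         (≤-trans (≤-reflexive (sym (^-assocʳ β (num i) (suc j))))
         (≤-trans (pow-mono (pow-nonNeg 0≤β (num i)) lo (suc j))
         (≤-trans (≤-reflexive comm)
         (≤-trans (pow-mono (pow-nonNeg 0≤X (suc j)) up (suc i))
                  (≤-reflexive (^-assocʳ β (2 ℕ.+ num j) (suc i))))))))

  approx : ℕ → ℚ
  approx j = + num j / suc j

  approx-≤ : ∀ i j → approx i ≤ approx j + + 2 / suc j
  approx-≤ i j = ≤-trans (/-≤ (num i) i (num j ℕ.+ 2) j (compare i j)) (≤-reflexive (/-+ (num j) 2 j))

  approx-cauchy : IsCauchy approx
  approx-cauchy ε 0<ε = N , λ i j le le′ → abs-≤ (oneSide i j le′)
      (≤-trans (≤-reflexive (flip (approx i) (approx j))) (oneSide j i le))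
    where
    N : ℕ
    N = proj₁ (2/-small ε 0<ε)
    flip : ∀ a c → - (a - c) ≡ c - a
    flip = solve 2 (λ a c → :- (a :- c) := c :- a) refl
    rearrange : ∀ a e → (a + e) - a ≡ e
    rearrange = solve 2 (λ a e → (a :+ e) :- a := e) refl
    oneSide : ∀ i j → N ℕ.≤ j → approx i - approx j ≤ ε
    oneSide i j le = ≤-trans (+-monoˡ-≤ (- approx j)
        (≤-trans (approx-≤ i j) (+-monoʳ-≤ (approx j) (proj₂ (2/-small ε 0<ε) j le))))
      (≤-reflexive (rearrange (approx j) ε))

-- The j-th term of log b n is m / k with k = j + 1 and b ^ m ≤ n ^ k ≤ b ^ (m + 2),
-- hence within 2 / k of the real number y with b ^ y = n.  The value at n = 0 is junk.
log : (b : ℝ) → 1ℝ <ℝ b → ℕ → ℝ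
log b 1<b zero    = 0ℝ
log b 1<b (suc n) = mkℝ (Log.approx b 1<b n) (Log.approx-cauchy b 1<b n)

log₁/[1-_] : ∀ p → 0ℝ <ℝ p → p <ℝ 1ℝ → ℕ → ℝ
log₁/[1- p ] 0<p p<1 = log (1/ℝ (1ℝ -ℝ p) (x<1⇒0<1-x {p} p<1)) (1<1/[1-x] {p} 0<p p<1)

------------------------------------------------------------------------
-- Finite simple graphs

-- A graph on Fin (suc n) is the adjacency vector from vertex zero to the other
-- vertices, together with a graph on the other vertices.
data Graph : ℕ → Set where
  []  : Graph 0
  _∷_ : ∀ {n} → Vec Bool n → Graph n → Graph (suc n)

adj : ∀ {n} → Graph n → Fin n → Fin n → Bool
adj (v ∷ G) zero    zero    = false
adj (v ∷ G) zero    (suc y) = lookup v y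
adj (v ∷ G) (suc x) zero    = lookup v x
adj (v ∷ G) (suc x) (suc y) = adj G x y

Adj : ∀ {n} → Graph n → Fin n → Fin n → Set
Adj G x y = T (adj G x y)

-- Adding the edge xy; no effect when x = y.
addEdge : ∀ {n} → Graph n → Fin n → Fin n → Graph n
addEdge (v ∷ G) zero    zero    = v ∷ G
addEdge (v ∷ G) zero    (suc y) = (v [ y ]≔ true) ∷ G
addEdge (v ∷ G) (suc x) zero    = (v [ x ]≔ true) ∷ G
addEdge (v ∷ G) (suc x) (suc y) = v ∷ addEdge G x y

pairs : ∀ n → List (Fin n × Fin n)
pairs n = filter (uncurry Finₚ._<?_) (cartesianProduct (allFin n) (allFin n))

edges : ∀ {n} → Graph n → List (Fin n × Fin n)
edges {n} G = filterᵇ (uncurry (adj G)) (pairs n)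

e : ∀ {n} → Graph n → ℕ
e G = length (edges G)

HasEdge : ∀ {n} → Graph n → Set
HasEdge G = ∃[ x ] ∃[ y ] Adj G x y

deg : ∀ {n} → Graph n → Fin n → ℕ
deg {n} G x = length (filterᵇ (adj G x) (allFin n))

-- The default value k of the minimum exceeds every degree, so it is attained
-- only by graphs without edges.
r : ∀ {k} → Graph k → ℕ
r {k} F = min k (map (λ (x , y) → deg F x ℕ.⊔ deg F y) (edges F))

infix 4 _↪_ _⊆_

_↪_ : ∀ {k n} → Graph k → Graph n → Set
_↪_ {k} {n} F H = ∃[ f ] Injective _≡_ _≡_ f × (∀ x y → Adj F x y → Adj H (f x) (f y))

_⊆_ : ∀ {n} → Graph n → Graph n → Set
H ⊆ G = ∀ x y → Adj H x y → Adj G x y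

IsSaturated : ∀ {k n} → Graph k → Graph n → Graph n → Set
IsSaturated F G H =
  H ⊆ G × ¬ (F ↪ H) × (∀ x y → Adj G x y → ¬ Adj H x y → F ↪ addEdge H x y)

anyVec? : ∀ {n} k {P : Vec (Fin n) k → Set} → (∀ v → Dec (P v)) → Dec (∃ P)
anyVec? zero    P? = map′ ([] ,_) (λ { ([] , h) → h }) (P? [])
anyVec? (suc k) P? = map′ (λ (x , v , h) → x ∷ v , h) (λ { (x ∷ v , h) → x , v , h })
  (Finₚ.any? λ x → anyVec? k λ v → P? (x ∷ v))

_↪?_ : ∀ {k n} (F : Graph k) (H : Graph n) → Dec (F ↪ H)
_↪?_ {k} F H = map′
  (λ (v , inj , hom) → lookup v , (λ {x} {y} → inj x y) , hom)
  (λ (f , inj , hom) → tabulate f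
    , (λ x y eq → inj (trans (sym (lookup∘tabulate f x)) (trans eq (lookup∘tabulate f y))))
    , (λ x y a → subst₂ (Adj H) (sym (lookup∘tabulate f x)) (sym (lookup∘tabulate f y)) (hom x y a)))
  (anyVec? k λ v →
    (Finₚ.all? λ x → Finₚ.all? λ y → (lookup v x Finₚ.≟ lookup v y) →-dec (x Finₚ.≟ y))
    ×-dec (Finₚ.all? λ x → Finₚ.all? λ y → T? (adj F x y) →-dec T? (adj H (lookup v x) (lookup v y))))

isSaturated? : ∀ {k n} (F : Graph k) (G H : Graph n) → Dec (IsSaturated F G H)
isSaturated? F G H =
  (Finₚ.all? λ x → Finₚ.all? λ y → T? (adj H x y) →-dec T? (adj G x y))
  ×-dec ¬? (F ↪? H)
  ×-dec (Finₚ.all? λ x → Finₚ.all? λ y →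
    T? (adj G x y) →-dec (¬? (T? (adj H x y)) →-dec (F ↪? addEdge H x y)))

allVecs : ∀ n → List (Vec Bool n)
allVecs zero    = [] ∷ []
allVecs (suc n) = cartesianProductWith _∷_ (false ∷ true ∷ []) (allVecs n)

allGraphs : ∀ n → List (Graph n)
allGraphs zero    = [] ∷ []
allGraphs (suc n) = cartesianProductWith _∷_ (allVecs n) (allGraphs n)

-- The default value e G bounds every term, so it is immaterial as soon as some
-- F-saturated subgraph exists, which is the case whenever F has an edge.
sat : ∀ {k n} → Graph n → Graph k → ℕ
sat {n = n} G F = min (e G) (map e (filter (isSaturated? F G) (allGraphs n)))

------------------------------------------------------------------------
-- The random graph 𝔾(n, p)

weight : ∀ {n} → ℝ → Graph n → ℝ
weight {n} p G = ∏ (map (λ (x , y) → if adj G x y then p else 1ℝ -ℝ p) (pairs n))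

ℙ : ∀ {n} → ℝ → (Graph n → Bool) → ℝ
ℙ {n} p S = ∑ (map (weight p) (filterᵇ S (allGraphs n)))

-- An event stated through real inequalities need not be decidable, so it is
-- measured from inside, by decidable events S n ⊆ E n whose probability tends
-- to 1.  Classically one may take S n = E n, which gives the usual notion.
WithHighProbability : ℝ → (∀ n → Graph n → Set) → Set
WithHighProbability p E = Σ (∀ n → Graph n → Bool) λ S →
  (∀ n G → T (S n G) → E n G) × ((λ n → ℙ p (S n)) ⟶ 1ℝ)

module Submission where

open import Algebra.Bundles using (CommutativeRing)
open import Data.Bool using (Bool; true; false; T; not; if_then_else_)
open import Data.Bool.Properties using (T?; T-≡; if-float)
open import Data.Empty using (⊥; ⊥-elim)
open import Data.Fin using (Fin; zero; suc)
import Data.Fin as Fin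
import Data.Fin.Properties as Finₚ
open import Data.Fin.Subset using (Subset; _∈_; _∩_) renaming (∣_∣ to card)
open import Data.Fin.Subset.Properties using (p⊆q⇒∣p∣≤∣q∣; anySubset?; ∣p∩q∣≤∣q∣; x∈p∩q⁺; x∈p∩q⁻)
import Data.Integer as ℤ
open import Data.List using (List; []; _∷_; _++_; length; map; filterᵇ; allFin; cartesianProduct; cartesianProductWith)
import Data.List as List
open import Data.List.Extrema.Nat using (argmin-all; min≤xs; v≤min⁺)
open import Data.List.Membership.Propositional using () renaming (_∈_ to _∈ₗ_)
open import Data.List.Membership.Propositional.Properties
  using (∈-filter⁺; ∈-filter⁻; ∈-map⁺; ∈-++⁺ˡ; ∈-++⁺ʳ; ∈-cartesianProduct⁺; ∈-allFin; ∈-lookup)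
open import Data.List.Properties using (map-++; map-tabulate; filter-++; length-++; length-map)
open import Data.List.Relation.Unary.All using (All; []; _∷_)
import Data.List.Relation.Unary.All as All
import Data.List.Relation.Unary.All.Properties as Allₚ
open import Data.List.Relation.Unary.AllPairs using (_∷_)
open import Data.List.Relation.Unary.Any using (here; there; index)
open import Data.List.Relation.Unary.Any.Properties using (lookup-index)
open import Data.List.Relation.Unary.Unique.Propositional using (Unique)
open import Data.List.Relation.Unary.Unique.Propositional.Properties using (allFin⁺; filter⁺)
open import Data.Nat using (ℕ; zero; suc)
import Data.Nat as ℕ
import Data.Nat.Properties as ℕₚ
import Data.Nat.Solver as ℕ-Solver
open import Data.Product using (Σ; ∃-syntax; _×_; _,_; proj₁; proj₂; uncurry)
import Data.Product as Product
open import Data.Rational using (ℚ; 0ℚ; 1ℚ; ½; _+_; _*_; _-_; -_; _≤_; _<_; _/_; nonNegative; positive)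
open import Data.Rational.Properties
open import Data.Rational.Solver using (module +-*-Solver)
open import Data.Sum using (_⊎_; inj₁; inj₂; [_,_]′)
open import Data.Vec using (Vec; []; _∷_; lookup)
import Data.Vec as Vec
import Data.Vec.Properties as Vecₚ
open import Defs
open import Function using (_∘_; id; case_of_)
open import Function.Bundles using (Equivalence)
open import Function.Definitions using (Injective)
open import Relation.Binary.Definitions using (tri<; tri≈; tri>)
open import Relation.Binary.PropositionalEquality
open import Relation.Nullary using (Dec; yes; no; ¬_; does)
open import Relation.Nullary.Decidable using (_×-dec_)
open CauchyLemmas
open LogLemmas
open CommutativeRing +-*-commutativeRing using (commutativeSemiring)
open import Algebra.Properties.CommutativeSemiring.Exp commutativeSemiring
  using (_^_; ^-assocʳ; ^-homo-*; ^-distrib-*)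
open import Algebra.Properties.CommutativeMonoid.Sum ℕₚ.+-0-commutativeMonoid
  using (sum; ∑-distrib-+; sum-cong-≗)

-- Let H be an F-saturated subgraph of G and let A be the set of vertices of
-- H-degree less than d = r(F) - 1.  If an edge xy of G inside A were missing in H,
-- adding it would create a copy of F in which some edge is mapped to xy, so x or y
-- would have degree at least r(F) - 1 in H.  So all edges of G inside A are edges
-- of H, and A spans at most d |A| edges of G.
--
-- It remains to see that with high probability no set of a = (2 + o(1)) log n
-- vertices spans at most a d edges, since then 2 e(H) >= d (n - a) by counting
-- degrees.  For 0 < t <= 1 the sum of t ^ e(G[A]) over the sets A of size a has
-- expectation C(n, a) (1 - p + p t) ^ C(a, 2), and it is at least t ^ (a d) if such
-- a set exists; Markov's inequality with t of order 1 / a gives the claim.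
--
-- A Cauchy real p enters only through its terms: the probability of an event in
-- the random graph is at index i the rational probability for the parameter p i.

-- Edges and degrees

𝟙 : Bool → ℕ
𝟙 false = 0
𝟙 true  = 1

length-filterᵇ-∷ : ∀ {A : Set} (p : A → Bool) x xs →
                   length (filterᵇ p (x ∷ xs)) ≡ 𝟙 (p x) ℕ.+ length (filterᵇ p xs)
length-filterᵇ-∷ p x xs with p x
... | true  = refl
... | false = refl

length-filterᵇ-map : ∀ {A B : Set} (p : B → Bool) (f : A → B) xs →
                     length (filterᵇ p (map f xs)) ≡ length (filterᵇ (p ∘ f) xs)
length-filterᵇ-map p f []       = refl
length-filterᵇ-map p f (x ∷ xs) = trans (length-filterᵇ-∷ p (f x) (map f xs))
  (trans (cong (𝟙 (p (f x)) ℕ.+_) (length-filterᵇ-map p f xs)) (sym (length-filterᵇ-∷ (p ∘ f) x xs)))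

allFin-suc : ∀ n → allFin (suc n) ≡ zero ∷ map suc (allFin n)
allFin-suc n = cong (zero ∷_) (sym (map-tabulate id suc))

count-suc : ∀ {n} (p : Fin (suc n) → Bool) →
            length (filterᵇ p (allFin (suc n))) ≡ 𝟙 (p zero) ℕ.+ length (filterᵇ (p ∘ suc) (allFin n))
count-suc {n} p = trans (cong (length ∘ filterᵇ p) (allFin-suc n))
  (trans (length-filterᵇ-∷ p zero (map suc (allFin n)))
         (cong (𝟙 (p zero) ℕ.+_) (length-filterᵇ-map p suc (allFin n))))

card-∷ : ∀ {n} b (v : Subset n) → card (b ∷ v) ≡ 𝟙 b ℕ.+ card v
card-∷ true  v = refl
card-∷ false v = refl

count-lookup : ∀ {n} (v : Subset n) → length (filterᵇ (lookup v) (allFin n)) ≡ card v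
count-lookup []      = refl
count-lookup (b ∷ v) = trans (count-suc (lookup (b ∷ v)))
  (trans (cong (𝟙 b ℕ.+_) (count-lookup v)) (sym (card-∷ b v)))

sum-lookup : ∀ {n} (v : Subset n) → sum (λ x → 𝟙 (lookup v x)) ≡ card v
sum-lookup []      = refl
sum-lookup (b ∷ v) = trans (cong (𝟙 b ℕ.+_) (sum-lookup v)) (sym (card-∷ b v))

deg-zero : ∀ {n} v (G : Graph n) → deg (v ∷ G) zero ≡ card v
deg-zero v G = trans (count-suc (adj (v ∷ G) zero)) (count-lookup v)

deg-suc : ∀ {n} v (G : Graph n) x → deg (v ∷ G) (suc x) ≡ 𝟙 (lookup v x) ℕ.+ deg G x
deg-suc v G x = count-suc (adj (v ∷ G) (suc x))

-- The pairs containing vertex zero come first, and the others are shifted copies of the pairs on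
-- `n` vertices. Through this, counts and products over `pairs` follow the recursive encoding of
-- graphs.
pairs-suc : ∀ n → pairs (suc n) ≡
            map (λ y → zero , suc y) (allFin n) ++ map (Product.map suc suc) (pairs n)
pairs-suc n = trans (cong (λ xs → List.filter lt? (cartesianProduct xs xs)) (allFin-suc n)) (trans
  (filter-++ lt? (map (zero ,_) (map suc (allFin n))) (cartesianProduct (map suc (allFin n)) (zero ∷ map suc (allFin n))))
  (cong₂ _++_ (row₀ (allFin n)) (rows (allFin n))))
  where
  lt? : ∀ {m} (xy : Fin m × Fin m) → Dec _
  lt? = uncurry Finₚ._<?_
  row₀ : ∀ ys → List.filter lt? (map (zero ,_) (map suc ys)) ≡ map (λ y → zero , suc {n} y) ys
  row₀ []       = refl
  row₀ (y ∷ ys) = cong ((zero , suc y) ∷_) (row₀ ys)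
  row : ∀ x ys → List.filter lt? (map (suc x ,_) (map suc ys)) ≡
                 map (Product.map suc (suc {n})) (List.filter lt? (map (x ,_) ys))
  row x []       = refl
  row x (y ∷ ys) with does (x Finₚ.<? y)
  ... | true  = cong ((suc x , suc y) ∷_) (row x ys)
  ... | false = row x ys
  rows : ∀ xs → List.filter lt? (cartesianProduct (map suc xs) (zero ∷ map suc (allFin n))) ≡
                map (Product.map suc suc) (List.filter lt? (cartesianProduct xs (allFin n)))
  rows []       = refl
  rows (x ∷ xs) = trans
    (filter-++ lt? (map (suc x ,_) (map suc (allFin n))) (cartesianProduct (map suc xs) (zero ∷ map suc (allFin n))))
    (trans (cong₂ _++_ (row x (allFin n)) (rows xs))
    (trans (sym (map-++ (Product.map suc suc) (List.filter lt? (map (x ,_) (allFin n))) _))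
           (cong (map (Product.map suc suc)) (sym (filter-++ lt? (map (x ,_) (allFin n)) (cartesianProduct xs (allFin n)))))))

e-∷ : ∀ {n} v (G : Graph n) → e (v ∷ G) ≡ card v ℕ.+ e G
e-∷ {n} v G = trans (cong (length ∘ filterᵇ p) (pairs-suc n))
  (trans (cong length (filter-++ (T? ∘ p) row _))
  (trans (length-++ (filterᵇ p row))
  (cong₂ ℕ._+_ (trans (length-filterᵇ-map p (λ y → zero , suc y) (allFin n)) (count-lookup v))
               (length-filterᵇ-map p (Product.map suc suc) (pairs n)))))
  where
  p : Fin (suc n) × Fin (suc n) → Bool
  p = uncurry (adj (v ∷ G))
  row : List (Fin (suc n) × Fin (suc n))
  row = map (λ y → zero , suc y) (allFin n)

-- Adding a vertex with row `v` adds `card v` twice to the degree sum: once as the degree of the new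
-- vertex, once as a unit at each of its neighbours.
handshake : ∀ {n} (G : Graph n) → sum (deg G) ≡ e G ℕ.+ e G
handshake []      = refl
handshake (v ∷ G) = trans (cong₂ ℕ._+_ (deg-zero v G)
    (trans (sum-cong-≗ (deg-suc v G))
    (trans (∑-distrib-+ (λ x → 𝟙 (lookup v x)) (deg G)) (cong₂ ℕ._+_ (sum-lookup v) (handshake G)))))
  (trans (rearrange (card v) (e G)) (sym (cong₂ ℕ._+_ (e-∷ v G) (e-∷ v G))))
  where
  open ℕ-Solver.+-*-Solver using (solve; _:+_; _:*_; _:=_)
  rearrange : ∀ a b → a ℕ.+ (a ℕ.+ (b ℕ.+ b)) ≡ (a ℕ.+ b) ℕ.+ (a ℕ.+ b)
  rearrange = solve 2 (λ a b → a :+ (a :+ (b :+ b)) := (a :+ b) :+ (a :+ b)) refl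

below : ∀ {n} → (Fin n → ℕ) → ℕ → Subset n
below f d = Vec.tabulate (λ x → f x ℕ.<ᵇ d)

∈-below⁻ : ∀ {n} (f : Fin n → ℕ) d x → x ∈ below f d → f x ℕ.< d
∈-below⁻ f d x x∈ = ℕₚ.<ᵇ⇒< (f x) d (Equivalence.from T-≡
  (trans (sym (Vecₚ.lookup∘tabulate _ x)) (Vecₚ.[]=⇒lookup x∈)))

-- Every vertex accounts for at least `d` on the right: through its own value if that is at least
-- `d`, and through the count of `below` otherwise.
sum+below : ∀ {n} (f : Fin n → ℕ) d → n ℕ.* d ℕ.≤ sum f ℕ.+ card (below f d) ℕ.* d
sum+below {zero}  f d = ℕ.z≤n
sum+below {suc n} f d = ℕₚ.≤-trans (ℕₚ.+-mono-≤ head (sum+below (f ∘ suc) d))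
  (ℕₚ.≤-reflexive (trans (rearrange (f zero) b d (sum (f ∘ suc)) (card A))
    (cong (λ c → sum f ℕ.+ c ℕ.* d) (sym (card-∷ (f zero ℕ.<ᵇ d) A)))))
  where
  open ℕ-Solver.+-*-Solver using (solve; _:+_; _:*_; _:=_)
  A : Subset n
  A = below (f ∘ suc) d
  b : ℕ
  b = 𝟙 (f zero ℕ.<ᵇ d)
  rearrange : ∀ x b d s c → (x ℕ.+ b ℕ.* d) ℕ.+ (s ℕ.+ c ℕ.* d) ≡ (x ℕ.+ s) ℕ.+ (b ℕ.+ c) ℕ.* d
  rearrange = solve 5 (λ x b d s c → (x :+ b :* d) :+ (s :+ c :* d) := (x :+ s) :+ (b :+ c) :* d) refl
  head : d ℕ.≤ f zero ℕ.+ b ℕ.* d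
  head with f zero ℕ.<ᵇ d in eq
  ... | true  = ℕₚ.≤-trans (ℕₚ.≤-reflexive (sym (ℕₚ.+-identityʳ d))) (ℕₚ.m≤n+m (d ℕ.+ 0) (f zero))
  ... | false = ℕₚ.≤-trans (ℕₚ.≮⇒≥ λ lt → subst T eq (ℕₚ.<⇒<ᵇ lt)) (ℕₚ.m≤m+n (f zero) 0)

-- Edges inside a set of vertices

-- An edge is counted in the row of its end of smaller index. The recursion follows that of `Graph`,
-- so that expectations factor row by row.
eIn : ∀ {n} → Subset n → Graph n → ℕ
eIn []          []      = 0
eIn (true  ∷ A) (v ∷ G) = card (A ∩ v) ℕ.+ eIn A G
eIn (false ∷ A) (v ∷ G) = eIn A G

Adj⇒∈ : ∀ {n} {v : Subset n} {y} → T (lookup v y) → y ∈ v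
Adj⇒∈ {v = v} {y} h = Vecₚ.lookup⇒[]= y v (Equivalence.to T-≡ h)

∈⇒Adj : ∀ {n} {v : Subset n} {y} → y ∈ v → T (lookup v y)
∈⇒Adj y∈v = Equivalence.from T-≡ (Vecₚ.[]=⇒lookup y∈v)

eIn-mono : ∀ {n} (A : Subset n) {G H : Graph n} →
           (∀ {x y} → x ∈ A → y ∈ A → Adj G x y → Adj H x y) → eIn A G ℕ.≤ eIn A H
eIn-mono []          {[]}    {[]}    h = ℕ.z≤n
eIn-mono (true ∷ A)  {v ∷ G} {w ∷ H} h = ℕₚ.+-mono-≤
  (p⊆q⇒∣p∣≤∣q∣ λ y∈ → case x∈p∩q⁻ A v y∈ of λ (y∈A , y∈v) →
    x∈p∩q⁺ (y∈A , Adj⇒∈ (h {zero} {suc _} Vec.here (Vec.there y∈A) (∈⇒Adj y∈v))))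
  (eIn-mono A λ {x} {y} x∈ y∈ → h {suc x} {suc y} (Vec.there x∈) (Vec.there y∈))
eIn-mono (false ∷ A) {v ∷ G} {w ∷ H} h =
  eIn-mono A λ {x} {y} x∈ y∈ → h {suc x} {suc y} (Vec.there x∈) (Vec.there y∈)

-- The row of a vertex of `A` is part of its neighbourhood. Each edge is charged to one end only,
-- which gives `d` per vertex, the threshold used in `Sparse`.
eIn≤card*d : ∀ {n} (A : Subset n) (G : Graph n) d → (∀ x → x ∈ A → deg G x ℕ.≤ d) →
             eIn A G ℕ.≤ card A ℕ.* d
eIn≤card*d []      []      d h = ℕ.z≤n
eIn≤card*d (b ∷ A) (v ∷ G) d h = add b h
  where
  tail : ∀ {b} → (∀ x → x ∈ (b ∷ A) → deg (v ∷ G) x ℕ.≤ d) → eIn A G ℕ.≤ card A ℕ.* d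
  tail h = eIn≤card*d A G d λ x x∈ → ℕₚ.≤-trans (ℕₚ.m≤n+m (deg G x) (𝟙 (lookup v x)))
    (ℕₚ.≤-trans (ℕₚ.≤-reflexive (sym (deg-suc v G x))) (h (suc x) (Vec.there x∈)))
  add : ∀ b′ → (∀ x → x ∈ (b′ ∷ A) → deg (v ∷ G) x ℕ.≤ d) → eIn (b′ ∷ A) (v ∷ G) ℕ.≤ card (b′ ∷ A) ℕ.* d
  add false h′ = tail h′
  add true  h′ = ℕₚ.+-mono-≤
    (ℕₚ.≤-trans (∣p∩q∣≤∣q∣ A v) (ℕₚ.≤-trans (ℕₚ.≤-reflexive (sym (deg-zero v G))) (h′ zero Vec.here)))
    (tail h′)

-- The first moment bound treats one exact set size, so a larger set of low-degree vertices is cut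
-- down to it.
shrink : ∀ {n} (A : Subset n) a → a ℕ.≤ card A → ∃[ B ] (∀ x → x ∈ B → x ∈ A) × card B ≡ a
shrink []          zero    _ = [] , (λ _ x∈ → x∈) , refl
shrink (false ∷ A) a       a≤ = case shrink A a a≤ of λ (B , B⊆A , eq) →
  false ∷ B , (λ { (suc x) (Vec.there x∈) → Vec.there (B⊆A x x∈) }) , eq
shrink (true ∷ A)  zero    _ = case shrink A zero ℕ.z≤n of λ (B , B⊆A , eq) →
  false ∷ B , (λ { (suc x) (Vec.there x∈) → Vec.there (B⊆A x x∈) }) , eq
shrink (true ∷ A)  (suc a) (ℕ.s≤s a≤) = case shrink A a a≤ of λ (B , B⊆A , eq) →
  true ∷ B , (λ { zero _ → Vec.here ; (suc x) (Vec.there x∈) → Vec.there (B⊆A x x∈) }) , cong suc eq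

Sparse : ∀ {n} → ℕ → ℕ → Graph n → Set
Sparse a d G = ∃[ B ] card B ≡ a × eIn B G ℕ.≤ a ℕ.* d

-- The vertices of H-degree below d span few edges of H, hence of G, so there
-- are fewer than a of them.
edges-bound : ∀ {n} (G H : Graph n) a d → ¬ Sparse a d G →
              (∀ {x y} → deg H x ℕ.< d → deg H y ℕ.< d → Adj G x y → Adj H x y) →
              n ℕ.* d ℕ.≤ (e H ℕ.+ e H) ℕ.+ a ℕ.* d
edges-bound {n} G H a d ¬sparse G⇒H with a ℕ.≤? card (below (deg H) d)
... | no  a≰ = ℕₚ.≤-trans (sum+below (deg H) d)
  (ℕₚ.+-mono-≤ (ℕₚ.≤-reflexive (handshake H)) (ℕₚ.*-monoˡ-≤ d (ℕₚ.<⇒≤ (ℕₚ.≰⇒> a≰))))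
... | yes a≤ = case shrink (below (deg H) d) a a≤ of λ (B , B⊆ , eq) →
  let low = λ x x∈ → ∈-below⁻ (deg H) d x (B⊆ x x∈) in
  ⊥-elim (¬sparse (B , eq , ℕₚ.≤-trans
    (eIn-mono B λ {x} {y} x∈ y∈ → G⇒H (low x x∈) (low y y∈))
    (subst (λ c → eIn B H ℕ.≤ c ℕ.* d) eq (eIn≤card*d B H d λ x x∈ → ℕₚ.<⇒≤ (low x x∈)))))

-- Saturated subgraphs

lookup-injective : ∀ {A : Set} {xs : List A} → Unique xs →
                   ∀ i j → List.lookup xs i ≡ List.lookup xs j → i ≡ j
lookup-injective (_ ∷ _)  zero    zero    _  = refl
lookup-injective (p ∷ _)  zero    (suc j) eq = ⊥-elim (All.lookup p (∈-lookup j) eq)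
lookup-injective (p ∷ _)  (suc i) zero    eq = ⊥-elim (All.lookup p (∈-lookup i) (sym eq))
lookup-injective (_ ∷ ps) (suc i) (suc j) eq = cong suc (lookup-injective ps i j eq)

-- Pigeonhole principle: sending a position in `xs` to a position of its image in `ys` is injective,
-- because `xs` has no repetitions and `f` is injective.
length-≤ : ∀ {A B : Set} (f : A → B) → Injective _≡_ _≡_ f → ∀ {xs ys} → Unique xs →
           (∀ {x} → x ∈ₗ xs → f x ∈ₗ ys) → length xs ℕ.≤ length ys
length-≤ f inj {xs} {ys} uniq f∈ = Finₚ.injective⇒≤ {f = λ i → index (f∈ (∈-lookup i))} λ {i} {j} eq →
  lookup-injective uniq i j (inj (trans (lookup-index (f∈ (∈-lookup i)))
    (trans (cong (List.lookup ys) eq) (sym (lookup-index (f∈ (∈-lookup j)))))))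

Adj-sym : ∀ {n} (G : Graph n) x y → Adj G x y → Adj G y x
Adj-sym (v ∷ G) zero    (suc y) h = h
Adj-sym (v ∷ G) (suc x) zero    h = h
Adj-sym (v ∷ G) (suc x) (suc y) h = Adj-sym G x y h

Adj-irrefl : ∀ {n} (G : Graph n) x → ¬ Adj G x x
Adj-irrefl (v ∷ G) (suc x) h = Adj-irrefl G x h

lookup-update : ∀ {n} (v : Vec Bool n) y z → T (lookup (v Vec.[ y ]≔ true) z) → T (lookup v z) ⊎ z ≡ y
lookup-update v y z h with z Finₚ.≟ y
... | yes z≡y = inj₂ z≡y
... | no  z≢y = inj₁ (subst T (Vecₚ.lookup∘updateAt′ z y z≢y v) h)

addEdge-Adj : ∀ {n} (H : Graph n) x y u w → Adj (addEdge H x y) u w →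
              Adj H u w ⊎ (u ≡ x × w ≡ y) ⊎ (u ≡ y × w ≡ x)
addEdge-Adj (v ∷ H) zero    zero    u       w       h = inj₁ h
addEdge-Adj (v ∷ H) zero    (suc y) zero    (suc w) h =
  [ inj₁ , (λ eq → inj₂ (inj₁ (refl , cong suc eq))) ]′ (lookup-update v y w h)
addEdge-Adj (v ∷ H) zero    (suc y) (suc u) zero    h =
  [ inj₁ , (λ eq → inj₂ (inj₂ (cong suc eq , refl))) ]′ (lookup-update v y u h)
addEdge-Adj (v ∷ H) zero    (suc y) (suc u) (suc w) h = inj₁ h
addEdge-Adj (v ∷ H) (suc x) zero    zero    (suc w) h =
  [ inj₁ , (λ eq → inj₂ (inj₂ (refl , cong suc eq))) ]′ (lookup-update v x w h)
addEdge-Adj (v ∷ H) (suc x) zero    (suc u) zero    h =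
  [ inj₁ , (λ eq → inj₂ (inj₁ (cong suc eq , refl))) ]′ (lookup-update v x u h)
addEdge-Adj (v ∷ H) (suc x) zero    (suc u) (suc w) h = inj₁ h
addEdge-Adj (v ∷ H) (suc x) (suc y) zero    (suc w) h = inj₁ h
addEdge-Adj (v ∷ H) (suc x) (suc y) (suc u) zero    h = inj₁ h
addEdge-Adj (v ∷ H) (suc x) (suc y) (suc u) (suc w) h with addEdge-Adj H x y u w h
... | inj₁ a                  = inj₁ a
... | inj₂ (inj₁ (eq₁ , eq₂)) = inj₂ (inj₁ (cong suc eq₁ , cong suc eq₂))
... | inj₂ (inj₂ (eq₁ , eq₂)) = inj₂ (inj₂ (cong suc eq₁ , cong suc eq₂))

-- The neighbours of `u` in `F` are mapped injectively to `H`-neighbours of `x` or to `y`, the only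
-- possible new neighbour of `x`.
deg-addEdge : ∀ {k n} (F : Graph k) (H : Graph n) x y (f : Fin k → Fin n) → Injective _≡_ _≡_ f →
              (∀ u w → Adj F u w → Adj (addEdge H x y) (f u) (f w)) →
              ∀ u → f u ≡ x → deg F u ℕ.≤ suc (deg H x)
deg-addEdge {k} {n} F H x y f inj hom u refl =
  length-≤ f inj {ys = y ∷ filterᵇ (adj H (f u)) (allFin n)} (filter⁺ (T? ∘ adj F u) (allFin⁺ k)) λ {w} w∈ →
    case addEdge-Adj H (f u) y (f u) (f w) (hom u w (proj₂ (∈-filter⁻ (T? ∘ adj F u) {xs = allFin k} w∈))) of λ where
      (inj₁ h)                   → there (∈-filter⁺ (T? ∘ adj H (f u)) (∈-allFin (f w)) h)
      (inj₂ (inj₁ (_ , fw≡y)))   → here fw≡y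
      -- This case forces `x = y`, and then `f w` is again `y`.
      (inj₂ (inj₂ (fu≡y , fw≡fu))) → here (trans fw≡fu fu≡y)

-- Makes the degree bound at one end of the added edge available at the other end.
addEdge-Adj-comm : ∀ {n} (H : Graph n) x y u w → Adj (addEdge H x y) u w → Adj (addEdge H y x) u w
addEdge-Adj-comm (v ∷ H) zero    zero    u       w       h = h
addEdge-Adj-comm (v ∷ H) zero    (suc y) u       w       h = h
addEdge-Adj-comm (v ∷ H) (suc x) zero    u       w       h = h
addEdge-Adj-comm (v ∷ H) (suc x) (suc y) zero    zero    h = h
addEdge-Adj-comm (v ∷ H) (suc x) (suc y) zero    (suc w) h = h
addEdge-Adj-comm (v ∷ H) (suc x) (suc y) (suc u) zero    h = h
addEdge-Adj-comm (v ∷ H) (suc x) (suc y) (suc u) (suc w) h = addEdge-Adj-comm H x y u w h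

-- `edges` lists an edge only with its smaller end first, so the two ends are compared before the
-- minimum is applied to them.
r≤⊔ : ∀ {k} (F : Graph k) u w → Adj F u w → r F ℕ.≤ deg F u ℕ.⊔ deg F w
r≤⊔ {k} F u w h = case Finₚ.<-cmp u w of λ where
    (tri< u<w _ _)  → ordered u w u<w h
    (tri≈ _ refl _) → ⊥-elim (Adj-irrefl F u h)
    (tri> _ _ w<u)  → subst (r F ℕ.≤_) (ℕₚ.⊔-comm (deg F w) (deg F u)) (ordered w u w<u (Adj-sym F u w h))
  where
  maxDeg : Fin k × Fin k → ℕ
  maxDeg (x , y) = deg F x ℕ.⊔ deg F y
  ordered : ∀ u w → u Fin.< w → Adj F u w → r F ℕ.≤ deg F u ℕ.⊔ deg F w
  ordered u w u<w h = All.lookup (min≤xs k (map maxDeg (edges F)))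
    (∈-map⁺ maxDeg (∈-filter⁺ (T? ∘ uncurry (adj F))
      (∈-filter⁺ (uncurry Finₚ._<?_) (∈-cartesianProduct⁺ (∈-allFin u) (∈-allFin w)) u<w) h))

-- The default value of the minimum is positive because an edge needs vertices, and the ends of
-- every listed edge have degree at least 1.
1≤r : ∀ {k} (F : Graph k) → HasEdge F → 1 ℕ.≤ r F
1≤r {suc k} F _ = v≤min⁺ {xs = map (λ (x , y) → deg F x ℕ.⊔ deg F y) (edges F)} (ℕ.s≤s ℕ.z≤n)
  (Allₚ.map⁺ (All.map (λ {(x , y)} h → ℕₚ.≤-trans (1≤deg x y h) (ℕₚ.m≤m⊔n (deg F x) (deg F y)))
    (Allₚ.all-filter (T? ∘ uncurry (adj F)) (pairs (suc k)))))
  where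
  1≤length : ∀ {A : Set} {x : A} {xs} → x ∈ₗ xs → 1 ℕ.≤ length xs
  1≤length (here _)  = ℕ.s≤s ℕ.z≤n
  1≤length (there _) = ℕ.s≤s ℕ.z≤n
  1≤deg : ∀ x y → Adj F x y → 1 ℕ.≤ deg F x
  1≤deg x y h = 1≤length (∈-filter⁺ (T? ∘ adj F x) (∈-allFin y) h)

-- An edge xy of G missing in H completes a copy of F, and an edge of F mapped
-- to xy has an end of degree at least r F.
saturated-edges : ∀ {k n} (F : Graph k) (G H : Graph n) → IsSaturated F G H →
                  ∀ {x y} → suc (deg H x) ℕ.< r F → suc (deg H y) ℕ.< r F → Adj G x y → Adj H x y
saturated-edges {k} {n} F G H (_ , free , sat) {x} {y} x< y< Gxy with T? (adj H x y)
... | yes Hxy = Hxy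
... | no ¬Hxy = ⊥-elim (case sat x y Gxy ¬Hxy of λ (f , inj , hom) →
    free (f , inj , λ u w Fuw → [ id , (λ new → ⊥-elim (absurd f inj hom u w Fuw new)) ]′
      (addEdge-Adj H x y (f u) (f w) (hom u w Fuw))))
  where
  absurd : ∀ (f : Fin k → Fin n) → Injective _≡_ _≡_ f → (∀ u w → Adj F u w → Adj (addEdge H x y) (f u) (f w)) →
           ∀ u w → Adj F u w → (f u ≡ x × f w ≡ y) ⊎ (f u ≡ y × f w ≡ x) → ⊥
  absurd f inj hom u w Fuw = [ (λ (eq₁ , eq₂) → small (at-x u eq₁) (at-y w eq₂))
                             , (λ (eq₁ , eq₂) → small (at-y u eq₁) (at-x w eq₂)) ]′
    where
    at-x : ∀ z → f z ≡ x → deg F z ℕ.< r F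
    at-x z eq = ℕₚ.≤-<-trans (deg-addEdge F H x y f inj hom z eq) x<
    at-y : ∀ z → f z ≡ y → deg F z ℕ.< r F
    at-y z eq = ℕₚ.≤-<-trans (deg-addEdge F H y x f inj
      (λ u w h → addEdge-Adj-comm H x y (f u) (f w) (hom u w h)) z eq) y<
    small : deg F u ℕ.< r F → deg F w ℕ.< r F → ⊥
    small u< w< = ℕₚ.<-irrefl refl (ℕₚ.<-≤-trans (ℕₚ.⊔-lub u< w<) (r≤⊔ F u w Fuw))

sat-bound : ∀ {k n} (F : Graph k) (G : Graph n) a d → r F ≡ suc d → ¬ Sparse a d G →
            n ℕ.* d ℕ.≤ (sat G F ℕ.+ sat G F) ℕ.+ a ℕ.* d
sat-bound {n = n} F G a d r≡ ¬sparse =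
  argmin-all id {P = λ m → n ℕ.* d ℕ.≤ (m ℕ.+ m) ℕ.+ a ℕ.* d}
    -- The default value `e G` of the minimum is the case `H = G`, where no edge is missing.
    (edges-bound G G a d ¬sparse λ _ _ → id)
    (Allₚ.map⁺ (All.map (λ {H} saturated → edges-bound G H a d ¬sparse
      λ x< y< → saturated-edges F G H saturated (big x<) (big y<))
      (Allₚ.all-filter (isSaturated? F G) (allGraphs n))))
  where
  big : ∀ {m} → m ℕ.< d → suc m ℕ.< r F
  big m<d = subst (_ ℕ.<_) (sym r≡) (ℕ.s≤s m<d)

-- Finite sums of rationals

ι : ℕ → ℚ
ι n = ℤ.+ n / 1

sumℚ prodℚ : ∀ {A : Set} → List A → (A → ℚ) → ℚ
sumℚ []       f = 0ℚ
sumℚ (x ∷ xs) f = f x + sumℚ xs f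
prodℚ []       f = 1ℚ
prodℚ (x ∷ xs) f = f x * prodℚ xs f

module _ {A : Set} where

  sumℚ-cong : ∀ {f g : A → ℚ} → (∀ x → f x ≡ g x) → ∀ xs → sumℚ xs f ≡ sumℚ xs g
  sumℚ-cong eq []       = refl
  sumℚ-cong eq (x ∷ xs) = cong₂ _+_ (eq x) (sumℚ-cong eq xs)

  prodℚ-cong : ∀ {f g : A → ℚ} → (∀ x → f x ≡ g x) → ∀ xs → prodℚ xs f ≡ prodℚ xs g
  prodℚ-cong eq []       = refl
  prodℚ-cong eq (x ∷ xs) = cong₂ _*_ (eq x) (prodℚ-cong eq xs)

  sumℚ-++ : ∀ (f : A → ℚ) xs ys → sumℚ (xs ++ ys) f ≡ sumℚ xs f + sumℚ ys f
  sumℚ-++ f []       ys = sym (+-identityˡ (sumℚ ys f))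
  sumℚ-++ f (x ∷ xs) ys = trans (cong (f x +_) (sumℚ-++ f xs ys)) (sym (+-assoc (f x) (sumℚ xs f) (sumℚ ys f)))

  prodℚ-++ : ∀ (f : A → ℚ) xs ys → prodℚ (xs ++ ys) f ≡ prodℚ xs f * prodℚ ys f
  prodℚ-++ f []       ys = sym (*-identityˡ (prodℚ ys f))
  prodℚ-++ f (x ∷ xs) ys = trans (cong (f x *_) (prodℚ-++ f xs ys)) (sym (*-assoc (f x) (prodℚ xs f) (prodℚ ys f)))

  sumℚ-+ : ∀ (f g : A → ℚ) xs → sumℚ xs (λ x → f x + g x) ≡ sumℚ xs f + sumℚ xs g
  sumℚ-+ f g []       = refl
  sumℚ-+ f g (x ∷ xs) = trans (cong (f x + g x +_) (sumℚ-+ f g xs))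
    (rearrange (f x) (g x) (sumℚ xs f) (sumℚ xs g))
    where
    open +-*-Solver
    rearrange : ∀ a b c d → (a + b) + (c + d) ≡ (a + c) + (b + d)
    rearrange = solve 4 (λ a b c d → (a :+ b) :+ (c :+ d) := (a :+ c) :+ (b :+ d)) refl

  sumℚ-*ˡ : ∀ c (f : A → ℚ) xs → sumℚ xs (λ x → c * f x) ≡ c * sumℚ xs f
  sumℚ-*ˡ c f []       = sym (*-zeroʳ c)
  sumℚ-*ˡ c f (x ∷ xs) = trans (cong (c * f x +_) (sumℚ-*ˡ c f xs)) (sym (*-distribˡ-+ c (f x) (sumℚ xs f)))

  sumℚ-nonNeg : ∀ {f : A → ℚ} → (∀ x → 0ℚ ≤ f x) → ∀ xs → 0ℚ ≤ sumℚ xs f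
  sumℚ-nonNeg f≥0 []       = ≤-refl
  sumℚ-nonNeg f≥0 (x ∷ xs) = ≤-trans (≤-reflexive (sym (+-identityˡ 0ℚ))) (+-mono-≤ (f≥0 x) (sumℚ-nonNeg f≥0 xs))

  prodℚ-nonNeg : ∀ {f : A → ℚ} → (∀ x → 0ℚ ≤ f x) → ∀ xs → 0ℚ ≤ prodℚ xs f
  prodℚ-nonNeg f≥0 []       = <⇒≤ 0<1
  prodℚ-nonNeg f≥0 (x ∷ xs) = *-nonNeg (f≥0 x) (prodℚ-nonNeg f≥0 xs)

  sumℚ-const : ∀ {f : A → ℚ} {c} {xs} → All (λ x → f x ≡ c) xs → sumℚ xs f ≡ ι (length xs) * c
  sumℚ-const {c = c} []                     = sym (*-zeroˡ c)
  sumℚ-const {f} {c} {x ∷ xs} (eq ∷ eqs) = trans (cong₂ _+_ eq (sumℚ-const eqs))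
    (trans (rearrange c (ι (length xs))) (cong (_* c) (sym (/-+ 1 (length xs) 0))))
    where
    open +-*-Solver
    rearrange : ∀ c l → c + l * c ≡ (1ℚ + l) * c
    rearrange = solve 2 (λ c l → c :+ l :* c := (con 1ℚ :+ l) :* c) refl

  ∈⇒≤sumℚ : ∀ {f : A → ℚ} → (∀ x → 0ℚ ≤ f x) → ∀ {x xs} → x ∈ₗ xs → f x ≤ sumℚ xs f
  ∈⇒≤sumℚ {f} f≥0 {x} {_ ∷ xs} (here refl) =
    ≤-trans (≤-reflexive (sym (+-identityʳ (f x)))) (+-monoʳ-≤ (f x) (sumℚ-nonNeg f≥0 xs))
  ∈⇒≤sumℚ {f} f≥0 {x} {y ∷ xs} (there x∈) =
    ≤-trans (∈⇒≤sumℚ f≥0 x∈) (≤-trans (≤-reflexive (sym (+-identityˡ (sumℚ xs f)))) (+-monoˡ-≤ (sumℚ xs f) (f≥0 y)))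

  sumℚ-filterᵇ : ∀ (S : A → Bool) (f : A → ℚ) xs →
                 sumℚ xs f ≡ sumℚ (filterᵇ S xs) f + sumℚ (filterᵇ (not ∘ S) xs) f
  sumℚ-filterᵇ S f []       = refl
  sumℚ-filterᵇ S f (x ∷ xs) with S x
  ... | true  = trans (cong (f x +_) (sumℚ-filterᵇ S f xs)) (sym (+-assoc (f x) _ _))
  ... | false = trans (cong (f x +_) (sumℚ-filterᵇ S f xs)) (rearrange (f x) (sumℚ (filterᵇ S xs) f) (sumℚ (filterᵇ (not ∘ S) xs) f))
    where
    open +-*-Solver
    rearrange : ∀ a b c → a + (b + c) ≡ b + (a + c)
    rearrange = solve 3 (λ a b c → a :+ (b :+ c) := b :+ (a :+ c)) refl

  -- Markov's inequality, in product form to avoid a division by `c`: summands in `S` are at least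
  -- `w x * c`, the others are nonnegative.
  markov : ∀ (S : A → Bool) {w Z : A → ℚ} {c} → (∀ x → 0ℚ ≤ w x) → (∀ x → 0ℚ ≤ Z x) → (∀ x → T (S x) → c ≤ Z x) →
           ∀ xs → sumℚ (filterᵇ S xs) w * c ≤ sumℚ xs (λ x → w x * Z x)
  markov S {w} {Z} {c} w≥0 Z≥0 large []       = ≤-reflexive (*-zeroˡ c)
  markov S {w} {Z} {c} w≥0 Z≥0 large (x ∷ xs) with S x | large x
  ... | true  | h = ≤-trans (≤-reflexive (*-distribʳ-+ c (w x) _))
    (+-mono-≤ (*-monoˡ-≤-nonNeg (w x) {{nonNegative (w≥0 x)}} (h _)) (markov S w≥0 Z≥0 large xs))
  ... | false | _ = ≤-trans (markov S w≥0 Z≥0 large xs)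
    (≤-trans (≤-reflexive (sym (+-identityˡ _))) (+-monoˡ-≤ _ (*-nonNeg (w≥0 x) (Z≥0 x))))

module _ {A B : Set} where

  sumℚ-map : ∀ (f : B → ℚ) (g : A → B) xs → sumℚ (map g xs) f ≡ sumℚ xs (f ∘ g)
  sumℚ-map f g []       = refl
  sumℚ-map f g (x ∷ xs) = cong (f (g x) +_) (sumℚ-map f g xs)

  prodℚ-map : ∀ (f : B → ℚ) (g : A → B) xs → prodℚ (map g xs) f ≡ prodℚ xs (f ∘ g)
  prodℚ-map f g []       = refl
  prodℚ-map f g (x ∷ xs) = cong (f (g x) *_) (prodℚ-map f g xs)

  sumℚ-swap : ∀ (f : A → B → ℚ) xs ys →
              sumℚ xs (λ x → sumℚ ys (f x)) ≡ sumℚ ys (λ y → sumℚ xs (λ x → f x y))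
  sumℚ-swap f []       ys = sym (trans (sumℚ-cong (λ _ → sym (*-zeroˡ 0ℚ)) ys)
    (trans (sumℚ-*ˡ 0ℚ (λ _ → 0ℚ) ys) (*-zeroˡ (sumℚ ys (λ _ → 0ℚ)))))
  sumℚ-swap f (x ∷ xs) ys = trans (cong (sumℚ ys (f x) +_) (sumℚ-swap f xs ys))
    (sym (sumℚ-+ (f x) (λ y → sumℚ xs (λ x → f x y)) ys))

-- Independence enters through this factorisation: rows and graphs are enumerated as Cartesian
-- products, and their weights are products.
sumℚ-product : ∀ {A B C : Set} (c : A → B → C) (f : A → ℚ) (g : B → ℚ) (h : C → ℚ) →
               (∀ x y → h (c x y) ≡ f x * g y) → ∀ xs ys →
               sumℚ (cartesianProductWith c xs ys) h ≡ sumℚ xs f * sumℚ ys g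
sumℚ-product c f g h eq []       ys = sym (*-zeroˡ (sumℚ ys g))
sumℚ-product c f g h eq (x ∷ xs) ys = trans (sumℚ-++ h (map (c x) ys) _)
  (trans (cong₂ _+_ (trans (trans (sumℚ-map h (c x) ys) (sumℚ-cong (eq x) ys)) (sumℚ-*ˡ (f x) g ys))
                    (sumℚ-product c f g h eq xs ys))
         (sym (*-distribʳ-+ (sumℚ ys g) (f x) (sumℚ xs f))))

-- Expectations over the random graph with rational edge probability

coin : ℚ → Bool → ℚ
coin p b = if b then p else 1ℚ - p

vecWeight : ∀ {n} → ℚ → Vec Bool n → ℚ
vecWeight p []      = 1ℚ
vecWeight p (b ∷ v) = coin p b * vecWeight p v

weightℚ : ∀ {n} → ℚ → Graph n → ℚ
weightℚ {n} p G = prodℚ (pairs n) (λ (x , y) → coin p (adj G x y))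

p≤q⇒0≤q-p : ∀ {p q} → p ≤ q → 0ℚ ≤ q - p
p≤q⇒0≤q-p {p} p≤q = ≤-trans (≤-reflexive (sym (+-inverseʳ p))) (+-monoˡ-≤ (- p) p≤q)

coin-nonNeg : ∀ {p} → 0ℚ ≤ p → p ≤ 1ℚ → ∀ b → 0ℚ ≤ coin p b
coin-nonNeg {p} 0≤p p≤1 true  = 0≤p
coin-nonNeg {p} 0≤p p≤1 false = p≤q⇒0≤q-p p≤1

weightℚ-∷ : ∀ {n} p v (G : Graph n) → weightℚ p (v ∷ G) ≡ vecWeight p v * weightℚ p G
weightℚ-∷ {n} p v G = trans (cong (λ xs → prodℚ xs c) (pairs-suc n))
  (trans (prodℚ-++ c (map (λ y → zero , suc y) (allFin n)) _)
  (cong₂ _*_ (trans (prodℚ-map c (λ y → zero , suc y) (allFin n)) (row v))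
             (prodℚ-map c (Product.map suc suc) (pairs n))))
  where
  c : Fin (suc n) × Fin (suc n) → ℚ
  c (x , y) = coin p (adj (v ∷ G) x y)
  row : ∀ {m} (v : Vec Bool m) → prodℚ (allFin m) (coin p ∘ lookup v) ≡ vecWeight p v
  row         []      = refl
  row {suc m} (b ∷ v) = trans (cong (λ xs → prodℚ xs (coin p ∘ lookup (b ∷ v))) (allFin-suc m))
    (cong (coin p b *_) (trans (prodℚ-map (coin p ∘ lookup (b ∷ v)) suc (allFin m)) (row v)))

weightℚ-nonNeg : ∀ {n p} → 0ℚ ≤ p → p ≤ 1ℚ → ∀ (G : Graph n) → 0ℚ ≤ weightℚ p G
weightℚ-nonNeg {n} 0≤p p≤1 G = prodℚ-nonNeg (λ (x , y) → coin-nonNeg 0≤p p≤1 (adj G x y)) (pairs n)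

-- The binomial coefficient `a` choose 2, the number of pairs inside a set of size `a`.
tri : ℕ → ℕ
tri zero    = 0
tri (suc a) = a ℕ.+ tri a

module _ (p : ℚ) where

  open +-*-Solver

  coin-sum : sumℚ (false ∷ true ∷ []) (coin p) ≡ 1ℚ
  coin-sum = solve 1 (λ p → (con 1ℚ :- p) :+ (p :+ con 0ℚ) := con 1ℚ) refl p

  allVecs-1 : ∀ n → sumℚ (allVecs n) (vecWeight p) ≡ 1ℚ
  allVecs-1 zero    = refl
  allVecs-1 (suc n) = trans
    (sumℚ-product _∷_ (coin p) (vecWeight p) (vecWeight p) (λ _ _ → refl) (false ∷ true ∷ []) (allVecs n))
    (trans (cong₂ _*_ coin-sum (allVecs-1 n)) (*-identityˡ 1ℚ))

  allGraphs-1 : ∀ n → sumℚ (allGraphs n) (weightℚ p) ≡ 1ℚ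
  allGraphs-1 zero    = refl
  allGraphs-1 (suc n) = trans
    (sumℚ-product _∷_ (vecWeight p) (weightℚ p) (weightℚ p) (weightℚ-∷ p) (allVecs n) (allGraphs n))
    (trans (cong₂ _*_ (allVecs-1 n) (allGraphs-1 n)) (*-identityˡ 1ℚ))

module _ (p t : ℚ) where

  open +-*-Solver

  -- The expectation of t ^ X for an indicator X of probability p.
  u : ℚ
  u = (1ℚ - p) + p * t

  coin-sum-t : sumℚ (false ∷ true ∷ []) (λ b → coin p b * t ^ 𝟙 b) ≡ u
  coin-sum-t = solve 2 (λ p t → (con 1ℚ :- p) :* con 1ℚ :+ (p :* (t :* con 1ℚ) :+ con 0ℚ) := (con 1ℚ :- p) :+ p :* t) refl p t

  interchange : ∀ a b c d → (a * b) * (c * d) ≡ (a * c) * (b * d)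
  interchange = solve 4 (λ a b c d → (a :* b) :* (c :* d) := (a :* c) :* (b :* d)) refl

  -- Each coordinate in `A` contributes the factor `u`; each of the others sums out to 1.
  allVecs-t : ∀ {n} (A : Subset n) → sumℚ (allVecs n) (λ v → vecWeight p v * t ^ card (A ∩ v)) ≡ u ^ card A
  allVecs-t []          = refl
  allVecs-t (true ∷ A)  = trans
    (sumℚ-product _∷_ (λ b → coin p b * t ^ 𝟙 b) (λ v → vecWeight p v * t ^ card (A ∩ v)) (λ v → vecWeight p v * t ^ card ((true ∷ A) ∩ v))
      (λ b v → trans (cong (λ k → (coin p b * vecWeight p v) * t ^ k) (card-∷ b (A ∩ v)))
        (trans (cong (coin p b * vecWeight p v *_) (^-homo-* t (𝟙 b) (card (A ∩ v))))
               (interchange (coin p b) (vecWeight p v) (t ^ 𝟙 b) (t ^ card (A ∩ v)))))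
      (false ∷ true ∷ []) (allVecs _))
    (cong₂ _*_ coin-sum-t (allVecs-t A))
  allVecs-t (false ∷ A) = trans
    (sumℚ-product _∷_ (coin p) (λ v → vecWeight p v * t ^ card (A ∩ v)) (λ v → vecWeight p v * t ^ card ((false ∷ A) ∩ v))
      (λ b v → *-assoc (coin p b) (vecWeight p v) (t ^ card (A ∩ v))) (false ∷ true ∷ []) (allVecs _))
    (trans (cong₂ _*_ (coin-sum p) (allVecs-t A)) (*-identityˡ _))

  -- The row of a vertex of `A` contributes `u` once for every later vertex of `A`, and the
  -- remaining rows sum out to 1. This makes one factor per pair inside `A`.
  allGraphs-t : ∀ {n} (A : Subset n) → sumℚ (allGraphs n) (λ G → weightℚ p G * t ^ eIn A G) ≡ u ^ tri (card A)
  allGraphs-t []                  = refl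
  allGraphs-t {suc n} (true ∷ A)  = trans
    (sumℚ-product _∷_ (λ v → vecWeight p v * t ^ card (A ∩ v)) (λ G → weightℚ p G * t ^ eIn A G) (λ G → weightℚ p G * t ^ eIn (true ∷ A) G)
      (λ v G → trans (cong₂ _*_ (weightℚ-∷ p v G) (^-homo-* t (card (A ∩ v)) (eIn A G)))
                     (interchange (vecWeight p v) (weightℚ p G) (t ^ card (A ∩ v)) (t ^ eIn A G)))
      (allVecs n) (allGraphs n))
    (trans (cong₂ _*_ (allVecs-t A) (allGraphs-t A)) (sym (^-homo-* u (card A) (tri (card A)))))
  allGraphs-t {suc n} (false ∷ A) = trans
    (sumℚ-product _∷_ (vecWeight p) (λ G → weightℚ p G * t ^ eIn A G) (λ G → weightℚ p G * t ^ eIn (false ∷ A) G)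
      (λ v G → trans (cong (_* t ^ eIn A G) (weightℚ-∷ p v G)) (*-assoc (vecWeight p v) (weightℚ p G) (t ^ eIn A G)))
      (allVecs n) (allGraphs n))
    (trans (cong₂ _*_ (allVecs-1 p n) (allGraphs-t A)) (*-identityˡ _))

-- First moment bound

subsets : ∀ n → ℕ → List (Subset n)
subsets zero    zero    = [] ∷ []
subsets zero    (suc a) = []
subsets (suc n) zero    = map (false ∷_) (subsets n zero)
subsets (suc n) (suc a) = map (true ∷_) (subsets n a) ++ map (false ∷_) (subsets n (suc a))

card-subsets : ∀ n a → All (λ A → card A ≡ a) (subsets n a)
card-subsets zero    zero    = refl ∷ []
card-subsets zero    (suc a) = []
card-subsets (suc n) zero    = Allₚ.map⁺ (card-subsets n zero)
card-subsets (suc n) (suc a) =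
  Allₚ.++⁺ (Allₚ.map⁺ (All.map (cong suc) (card-subsets n a))) (Allₚ.map⁺ (card-subsets n (suc a)))

∈-subsets : ∀ {n} (A : Subset n) → A ∈ₗ subsets n (card A)
∈-subsets []          = here refl
∈-subsets (true ∷ A)  = ∈-++⁺ˡ (∈-map⁺ (true ∷_) (∈-subsets A))
∈-subsets {suc n} (false ∷ A) with card A | ∈-subsets A
... | zero  | A∈ = ∈-map⁺ (false ∷_) A∈
... | suc a | A∈ = ∈-++⁺ʳ (map (true ∷_) (subsets n a)) (∈-map⁺ (false ∷_) A∈)

-- A crude bound for the binomial coefficient, by Pascal's rule and
-- `n ^ a + n ^ (a + 1) = (n + 1) * n ^ a`.
length-subsets : ∀ n a → length (subsets n a) ℕ.≤ n ℕ.^ a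
length-subsets zero    zero    = ℕₚ.≤-refl
length-subsets zero    (suc a) = ℕ.z≤n
length-subsets (suc n) zero    = ℕₚ.≤-trans (ℕₚ.≤-reflexive (length-map (false ∷_) (subsets n zero))) (length-subsets n zero)
length-subsets (suc n) (suc a) = ℕₚ.≤-trans
  (ℕₚ.≤-reflexive (trans (length-++ (map (true ∷_) (subsets n a)))
    (cong₂ ℕ._+_ (length-map (true ∷_) (subsets n a)) (length-map (false ∷_) (subsets n (suc a))))))
  (ℕₚ.≤-trans (ℕₚ.+-mono-≤ (length-subsets n a) (length-subsets n (suc a)))
              (ℕₚ.*-monoʳ-≤ (suc n) (ℕₚ.^-monoˡ-≤ a (ℕₚ.n≤1+n n))))

sparse? : ∀ {n} a d (G : Graph n) → Dec (Sparse a d G)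
sparse? a d G = anySubset? λ B → (card B ℕ.≟ a) ×-dec (eIn B G ℕ.≤? a ℕ.* d)

ι-mono : ∀ {m n} → m ℕ.≤ n → ι m ≤ ι n
ι-mono {m} {n} le = /-≤ m 0 n 0 (ℕₚ.*-monoˡ-≤ 1 le)

ι-nonNeg : ∀ n → 0ℚ ≤ ι n
ι-nonNeg n = ι-mono {0} {n} ℕ.z≤n

ι-+ : ∀ m n → ι (m ℕ.+ n) ≡ ι m + ι n
ι-+ m n = /-+ m n 0

ι-* : ∀ m n → ι (m ℕ.* n) ≡ ι m * ι n
ι-* zero    n = sym (*-zeroˡ (ι n))
ι-* (suc m) n = trans (ι-+ n (m ℕ.* n)) (trans (cong (ι n +_) (ι-* m n))
  (trans (rearrange (ι n) (ι m)) (cong (_* ι n) (sym (ι-+ 1 m)))))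
  where
  open +-*-Solver
  rearrange : ∀ c l → c + l * c ≡ (1ℚ + l) * c
  rearrange = solve 2 (λ c l → c :+ l :* c := (con 1ℚ :+ l) :* c) refl

ι-^ : ∀ m k → ι (m ℕ.^ k) ≡ ι m ^ k
ι-^ m zero    = refl
ι-^ m (suc k) = trans (ι-* m (m ℕ.^ k)) (cong (ι m *_) (ι-^ m k))

pow-antitone : ∀ {t} → 0ℚ ≤ t → t ≤ 1ℚ → ∀ {k m} → k ℕ.≤ m → t ^ m ≤ t ^ k
pow-antitone 0≤t t≤1 {m = zero}  ℕ.z≤n = ≤-refl
pow-antitone 0≤t t≤1 {m = suc m} ℕ.z≤n = ≤-trans
  (*-mono 0≤t t≤1 (pow-nonNeg 0≤t m) (pow-antitone 0≤t t≤1 {m = m} ℕ.z≤n)) (≤-reflexive (*-identityˡ 1ℚ))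
pow-antitone {t} 0≤t t≤1 (ℕ.s≤s le) = *-monoˡ-≤-nonNeg t {{nonNegative 0≤t}} (pow-antitone 0≤t t≤1 le)

sparseProb : ℚ → ∀ n → ℕ → ℕ → ℚ
sparseProb p n a d = sumℚ (filterᵇ (does ∘ sparse? a d) (allGraphs n)) (weightℚ p)

-- Markov's inequality for `Z`. As `t ≤ 1`, one sparse set alone contributes at least `t ^ (a * d)`,
-- and the expectation is a sum of at most `n ^ a` equal terms.
sparseProb-bound : ∀ {p t} → 0ℚ ≤ p → p ≤ 1ℚ → 0ℚ ≤ t → t ≤ 1ℚ → ∀ n a d →
                   sparseProb p n a d * t ^ (a ℕ.* d) ≤ ι n ^ a * u p t ^ tri a
sparseProb-bound {p} {t} 0≤p p≤1 0≤t t≤1 n a d = ≤-trans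
  (markov (does ∘ sparse? a d) {Z = Z} (weightℚ-nonNeg 0≤p p≤1) Z≥0 large (allGraphs n))
  (≤-trans (≤-reflexive expectation)
  (*-monoʳ-≤-nonNeg (u p t ^ tri a) {{nonNegative (pow-nonNeg 0≤u (tri a))}}
    (≤-trans (ι-mono {length (subsets n a)} {n ℕ.^ a} (length-subsets n a)) (≤-reflexive (ι-^ n a)))))
  where
  Z : Graph n → ℚ
  Z G = sumℚ (subsets n a) (λ A → t ^ eIn A G)
  Z≥0 : ∀ G → 0ℚ ≤ Z G
  Z≥0 G = sumℚ-nonNeg (λ A → pow-nonNeg 0≤t (eIn A G)) (subsets n a)
  0≤u : 0ℚ ≤ u p t
  0≤u = ≤-trans (≤-reflexive (sym (+-identityˡ 0ℚ))) (+-mono-≤ (p≤q⇒0≤q-p p≤1) (*-nonNeg 0≤p 0≤t))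
  large : ∀ G → T (does (sparse? a d G)) → t ^ (a ℕ.* d) ≤ Z G
  large G h with sparse? a d G
  ... | yes (B , refl , e≤) = ≤-trans (pow-antitone 0≤t t≤1 e≤)
    (∈⇒≤sumℚ {f = λ A → t ^ eIn A G} (λ A → pow-nonNeg 0≤t (eIn A G)) (∈-subsets B))
  expectation : sumℚ (allGraphs n) (λ G → weightℚ p G * Z G) ≡ ι (length (subsets n a)) * u p t ^ tri a
  expectation = trans
    (sumℚ-cong (λ G → sym (sumℚ-*ˡ (weightℚ p G) (λ A → t ^ eIn A G) (subsets n a))) (allGraphs n))
    (trans (sumℚ-swap (λ G A → weightℚ p G * t ^ eIn A G) (allGraphs n) (subsets n a))
    (sumℚ-const (All.map (λ {A} eq → trans (allGraphs-t p t A) (cong (λ c → u p t ^ tri c) eq)) (card-subsets n a))))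

-- Terms of the sequences defining real probabilities

seq-∑ : ∀ {A : Set} (f : A → ℝ) xs i → seq (∑ (map f xs)) i ≡ sumℚ xs (λ x → seq (f x) i)
seq-∑ f []       i = refl
seq-∑ f (x ∷ xs) i = cong (seq (f x) i +_) (seq-∑ f xs i)

seq-∏ : ∀ {A : Set} (f : A → ℝ) xs i → seq (∏ (map f xs)) i ≡ prodℚ xs (λ x → seq (f x) i)
seq-∏ f []       i = refl
seq-∏ f (x ∷ xs) i = cong (seq (f x) i *_) (seq-∏ f xs i)

seq-weight : ∀ {n} p (G : Graph n) i → seq (weight p G) i ≡ weightℚ (seq p i) G
seq-weight {n} p G i = trans (seq-∏ (λ (x , y) → if adj G x y then p else 1ℝ -ℝ p) (pairs n) i)
  (prodℚ-cong (λ (x , y) → if-float (λ z → seq z i) (adj G x y)) (pairs n))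

seq-ℙ : ∀ {n} p (S : Graph n → Bool) i →
        seq (ℙ p S) i ≡ sumℚ (filterᵇ S (allGraphs n)) (weightℚ (seq p i))
seq-ℙ {n} p S i = trans (seq-∑ (weight p) (filterᵇ S (allGraphs n)) i)
  (sumℚ-cong (λ G → seq-weight p G i) (filterᵇ S (allGraphs n)))

-- The total weight is 1 for every rational parameter, so complementation is exact at each index,
-- even for early terms of `p` outside the unit interval.
seq-ℙ-dense : ∀ {n} p a d i →
              sparseProb (seq p i) n a d + seq (ℙ {n} p (not ∘ does ∘ sparse? a d)) i ≡ 1ℚ
seq-ℙ-dense {n} p a d i = trans (cong (sparseProb (seq p i) n a d +_) (seq-ℙ {n} p (not ∘ does ∘ sparse? a d) i))
  (trans (sym (sumℚ-filterᵇ (does ∘ sparse? a d) (weightℚ (seq p i)) (allGraphs n))) (allGraphs-1 (seq p i) n))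

-- Asymptotic estimates

1^ : ∀ n → 1ℚ ^ n ≡ 1ℚ
1^ zero    = refl
1^ (suc n) = trans (*-identityˡ (1ℚ ^ n)) (1^ n)

pow-inverse : ∀ x y → x * y ≡ 1ℚ → ∀ n → x ^ n * y ^ n ≡ 1ℚ
pow-inverse x y eq n = trans (sym (^-distrib-* x y n)) (trans (cong (_^ n) eq) (1^ n))

p≤p+q : ∀ p {q} → 0ℚ ≤ q → p ≤ p + q
p≤p+q p 0≤q = ≤-trans (≤-reflexive (sym (+-identityʳ p))) (+-monoʳ-≤ p 0≤q)

-- The induction rests on `(1 + x) (1 - (n + 1) x) = (1 - n x) - (n + 1) x ^ 2`. It stands in for an
-- exponential estimate: `(1 + x) ^ n ≤ 2` as soon as `n x ≤ 1/2`.
reverse-bernoulli : ∀ {x} → 0ℚ ≤ x → ∀ n → (1ℚ + x) ^ n * (1ℚ - ι n * x) ≤ 1ℚ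
reverse-bernoulli {x} 0≤x zero = ≤-reflexive (base x)
  where
  open +-*-Solver
  base : ∀ x → 1ℚ * (1ℚ - 0ℚ * x) ≡ 1ℚ
  base = solve 1 (λ x → con 1ℚ :* (con 1ℚ :- con 0ℚ :* x) := con 1ℚ) refl
reverse-bernoulli {x} 0≤x (suc n) = ≤-trans (p≤p+q _ error) (≤-trans (≤-reflexive eq) (reverse-bernoulli 0≤x n))
  where
  open +-*-Solver
  P : ℚ
  P = (1ℚ + x) ^ n
  error : 0ℚ ≤ P * (ι (suc n) * (x * x))
  error = *-nonNeg (pow-nonNeg (≤-trans (<⇒≤ 0<1) (p≤p+q 1ℚ 0≤x)) n) (*-nonNeg (ι-nonNeg (suc n)) (*-nonNeg 0≤x 0≤x))
  rearrange : ∀ x P c → ((1ℚ + x) * P) * (1ℚ - (1ℚ + c) * x) + P * ((1ℚ + c) * (x * x)) ≡ P * (1ℚ - c * x)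
  rearrange = solve 3 (λ x P c → ((con 1ℚ :+ x) :* P) :* (con 1ℚ :- (con 1ℚ :+ c) :* x) :+ P :* ((con 1ℚ :+ c) :* (x :* x))
    := P :* (con 1ℚ :- c :* x)) refl
  eq : ((1ℚ + x) * P) * (1ℚ - ι (suc n) * x) + P * (ι (suc n) * (x * x)) ≡ P * (1ℚ - ι n * x)
  eq = trans (cong (λ c → ((1ℚ + x) * P) * (1ℚ - c * x) + P * (c * (x * x))) (ι-+ 1 n)) (rearrange x P (ι n))

tri-double : ∀ k → tri (suc k) ℕ.+ tri (suc k) ≡ k ℕ.* suc k
tri-double zero    = refl
tri-double (suc k) = trans (rearrange k (tri k)) (trans (cong ((2 ℕ.+ (k ℕ.+ k)) ℕ.+_) (tri-double k)) (rearrange′ k))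
  where
  open ℕ-Solver.+-*-Solver using (solve; _:+_; _:*_; _:=_; con)
  rearrange : ∀ k t → ((1 ℕ.+ k) ℕ.+ (k ℕ.+ t)) ℕ.+ ((1 ℕ.+ k) ℕ.+ (k ℕ.+ t)) ≡ (2 ℕ.+ (k ℕ.+ k)) ℕ.+ ((k ℕ.+ t) ℕ.+ (k ℕ.+ t))
  rearrange = solve 2 (λ k t → ((con 1 :+ k) :+ (k :+ t)) :+ ((con 1 :+ k) :+ (k :+ t)) := (con 2 :+ (k :+ k)) :+ ((k :+ t) :+ (k :+ t))) refl
  rearrange′ : ∀ k → (2 ℕ.+ (k ℕ.+ k)) ℕ.+ k ℕ.* (1 ℕ.+ k) ≡ (1 ℕ.+ k) ℕ.* (2 ℕ.+ k)
  rearrange′ = solve 1 (λ k → (con 2 :+ (k :+ k)) :+ k :* (con 1 :+ k) := (con 1 :+ k) :* (con 2 :+ k)) refl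

suc≤2^ : ∀ w → suc w ℕ.≤ 2 ℕ.^ w
suc≤2^ zero    = ℕₚ.≤-refl
suc≤2^ (suc w) = ℕₚ.≤-trans (ℕₚ.+-mono-≤ (ℕₚ.≤-trans (ℕ.s≤s ℕ.z≤n) (suc≤2^ w)) (suc≤2^ w))
  (ℕₚ.≤-reflexive (cong (2 ℕ.^ w ℕ.+_) (sym (ℕₚ.+-identityʳ (2 ℕ.^ w)))))

^-distribʳ-*ℕ : ∀ m n k → (m ℕ.* n) ℕ.^ k ≡ m ℕ.^ k ℕ.* n ℕ.^ k
^-distribʳ-*ℕ m n zero    = refl
^-distribʳ-*ℕ m n (suc k) = trans (cong (m ℕ.* n ℕ.*_) (^-distribʳ-*ℕ m n k))
  (ℕₚ.[m*n]*[o*p]≡[m*o]*[n*p] m n (m ℕ.^ k) (n ℕ.^ k))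

n≤n^w : ∀ n {w} → 1 ℕ.≤ w → n ℕ.≤ n ℕ.^ w
n≤n^w zero    _            = ℕ.z≤n
n≤n^w (suc n) {suc w} _    = ℕₚ.m≤m*n (suc n) (suc n ℕ.^ w) {{ℕₚ.m^n≢0 (suc n) w}}

-- Explicit first moment estimate for a rational edge probability

module Estimate (κ d : ℕ) (1≤κ : 1 ℕ.≤ κ) where

  -- Chosen so that `base ^ w` dominates `8 * scale ^ (2 d)`: the 32 is the factor 2 of `scale`
  -- times the 16 of `size≤`.
  base : ℕ
  base = 8 ℕ.* (32 ℕ.* κ) ℕ.^ (2 ℕ.* d)

  -- Abstract, since unfolding the numerals during unification is slow.
  abstract
    exponent : ℕ
    exponent = κ ℕ.* base

    exponent≡ : exponent ≡ κ ℕ.* base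
    exponent≡ = refl

  -- For m close to 2 log n, the summand exponent * w makes β ^ size large enough
  -- to beat the factor 8 * scale ^ (2 d) as well as n ^ 2.
  size : ℕ → ℕ → ℕ
  size m w = suc ((2 ℕ.+ m) ℕ.+ exponent ℕ.* w)

  -- The first moment bound is applied with t = 1 / scale.
  scale : ℕ → ℕ → ℕ
  scale m w = (2 ℕ.* κ) ℕ.* size m w

  module _ (m w : ℕ) (exponent≤w : exponent ℕ.≤ w) (1≤w : 1 ℕ.≤ w) (m< : m ℕ.< suc w ℕ.* suc w) where

    -- Each of the summands 3, `m` and `exponent * w` is at most `4 ^ w`, and three times `4 ^ w` is
    -- at most `16 ^ w`.
    size≤ : size m w ℕ.≤ 16 ℕ.^ w
    size≤ = ℕₚ.≤-trans
      (ℕₚ.+-mono-≤ 3≤ (ℕₚ.+-mono-≤ (ℕₚ.≤-trans (ℕₚ.<⇒≤ m<) sq)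
        (ℕₚ.≤-trans (ℕₚ.*-mono-≤ (ℕₚ.≤-trans exponent≤w (ℕₚ.n≤1+n w)) (ℕₚ.n≤1+n w)) sq)))
      (ℕₚ.≤-trans (ℕₚ.≤-reflexive (cong (λ y → X ℕ.+ (X ℕ.+ y)) (sym (ℕₚ.+-identityʳ X))))
      (ℕₚ.≤-trans (ℕₚ.*-monoˡ-≤ X 3≤) (ℕₚ.≤-reflexive (sym (^-distribʳ-*ℕ 4 4 w)))))
      where
      X : ℕ
      X = 4 ℕ.^ w
      3≤ : 3 ℕ.≤ X
      3≤ = ℕₚ.≤-trans (ℕ.s≤s (ℕ.s≤s (ℕ.s≤s ℕ.z≤n))) (n≤n^w 4 1≤w)
      sq : suc w ℕ.* suc w ℕ.≤ X
      sq = ℕₚ.≤-trans (ℕₚ.*-mono-≤ (suc≤2^ w) (suc≤2^ w)) (ℕₚ.≤-reflexive (sym (^-distribʳ-*ℕ 2 2 w)))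

    scale-bound : 8 ℕ.* scale m w ℕ.^ (2 ℕ.* d) ℕ.≤ base ℕ.^ w
    scale-bound = ℕₚ.≤-trans
      (ℕₚ.*-mono-≤ (n≤n^w 8 1≤w) (ℕₚ.^-monoˡ-≤ (2 ℕ.* d) (ℕₚ.≤-trans
        (ℕₚ.*-mono-≤ (n≤n^w (2 ℕ.* κ) 1≤w) size≤)
        (ℕₚ.≤-reflexive (trans (sym (^-distribʳ-*ℕ (2 ℕ.* κ) 16 w)) (cong (ℕ._^ w) (32κ κ)))))))
      (ℕₚ.≤-reflexive (trans (cong (8 ℕ.^ w ℕ.*_) (trans (ℕₚ.^-*-assoc (32 ℕ.* κ) w (2 ℕ.* d))
          (trans (cong ((32 ℕ.* κ) ℕ.^_) (ℕₚ.*-comm w (2 ℕ.* d))) (sym (ℕₚ.^-*-assoc (32 ℕ.* κ) (2 ℕ.* d) w)))))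
        (sym (^-distribʳ-*ℕ 8 ((32 ℕ.* κ) ℕ.^ (2 ℕ.* d)) w))))
      where
      open ℕ-Solver.+-*-Solver using (solve; _:+_; _:*_; _:=_; con)
      32κ : ∀ κ → (2 ℕ.* κ) ℕ.* 16 ≡ 32 ℕ.* κ
      32κ = solve 1 (λ κ → (con 2 :* κ) :* con 16 := con 32 :* κ) refl

    module _ {p β δ : ℚ} {N : ℕ} (0≤p : 0ℚ ≤ p) (p≤1 : p ≤ 1ℚ) (0<δ : 0ℚ < δ) (p≤κ[1-p] : p ≤ ι κ * (1ℚ - p))
             (1≤κδ : 1ℚ ≤ ι κ * δ) (1+δ≤β : 1ℚ + δ ≤ β) (β-inverse : β * (1ℚ - p) ≡ 1ℚ)
             (N²≤ : ι N ^ 2 ≤ β ^ (2 ℕ.+ m)) where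

      private
        open +-*-Solver
        k a T₀ : ℕ
        k  = (2 ℕ.+ m) ℕ.+ exponent ℕ.* w
        a  = size m w
        T₀ = scale m w
        q x t v : ℚ
        q = 1ℚ - p
        1≤scale : 1 ℕ.≤ T₀
        1≤scale = ℕₚ.*-mono-≤ (ℕₚ.*-mono-≤ {1} {2} (ℕ.s≤s ℕ.z≤n) 1≤κ) (ℕ.s≤s ℕ.z≤n)
        0<ιT : 0ℚ < ι T₀
        0<ιT = <-≤-trans 0<1 (ι-mono {1} {T₀} 1≤scale)
        t = inv (ι T₀) 0<ιT
        x = ι κ * t
        v = u p t

        0≤t : 0ℚ ≤ t
        0≤t = <⇒≤ (inv-pos (ι T₀) 0<ιT)
        t-inverse : t * ι T₀ ≡ 1ℚ
        t-inverse = inv-inverseˡ (ι T₀) 0<ιT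
        t≤1 : t ≤ 1ℚ
        t≤1 = ≤-trans (≤-reflexive (sym (*-identityʳ t)))
          (≤-trans (*-mono 0≤t ≤-refl (<⇒≤ 0<1) (ι-mono {1} {T₀} 1≤scale)) (≤-reflexive t-inverse))
        0≤q : 0ℚ ≤ q
        0≤q = p≤q⇒0≤q-p p≤1
        0≤x : 0ℚ ≤ x
        0≤x = *-nonNeg (ι-nonNeg κ) 0≤t
        0≤v : 0ℚ ≤ v
        0≤v = ≤-trans 0≤q (p≤p+q q (*-nonNeg 0≤p 0≤t))
        0≤β : 0ℚ ≤ β
        0≤β = Base.0≤β δ 0<δ 1+δ≤β

        -- `p ≤ κ q` turns the summand `p * t` of `u` into the relative error `x = κ * t`.
        v≤ : v ≤ q * (1ℚ + x)
        v≤ = ≤-trans (+-monoʳ-≤ q (≤-trans (*-mono 0≤p p≤κ[1-p] 0≤t ≤-refl) (≤-reflexive (rearrange₁ (ι κ) q t))))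
          (≤-reflexive (rearrange₂ q x))
          where
          rearrange₁ : ∀ c q t → (c * q) * t ≡ q * (c * t)
          rearrange₁ = solve 3 (λ c q t → (c :* q) :* t := q :* (c :* t)) refl
          rearrange₂ : ∀ q x → q + q * x ≡ q * (1ℚ + x)
          rearrange₂ = solve 2 (λ q x → q :+ q :* x := q :* (con 1ℚ :+ x)) refl

        -- As `t` is the inverse of `2 * κ * a` and `a = k + 1`, the product `x * (1 + k)` is
        -- exactly one half.
        half : ½ ≤ 1ℚ - ι k * x
        half = ≤-trans (p≤p+q ½ 0≤x) (≤-reflexive (trans (rearrange (ι k) x)
          (cong (λ h → (½ + h) - ι k * x) total)))
          where
          rearrange : ∀ k x → ½ + x ≡ (½ + x * (1ℚ + k)) - k * x
          rearrange = solve 2 (λ k x → con ½ :+ x := (con ½ :+ x :* (con 1ℚ :+ k)) :- k :* x) refl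
          rearrange′ : ∀ c t a → (c * t) * a ≡ ½ * (t * ((ι 2 * c) * a))
          rearrange′ = solve 3 (λ c t a → (c :* t) :* a := con ½ :* (t :* ((con (ι 2) :* c) :* a))) refl
          total : x * (1ℚ + ι k) ≡ ½
          total = trans (cong (x *_) (sym (ι-+ 1 k))) (trans (rearrange′ (ι κ) t (ι a))
            (cong (½ *_) (trans (cong (t *_) (trans (cong (_* ι a) (sym (ι-* 2 κ))) (sym (ι-* (2 ℕ.* κ) a)))) t-inverse)))

        growth : (1ℚ + x) ^ k ≤ ι 2
        growth = ≤-trans (≤-reflexive (rearrange ((1ℚ + x) ^ k)))
          (≤-trans (*-monoˡ-≤-nonNeg (ι 2) (≤-trans
            (*-monoˡ-≤-nonNeg ((1ℚ + x) ^ k) {{nonNegative (pow-nonNeg (≤-trans (<⇒≤ 0<1) (p≤p+q 1ℚ 0≤x)) k)}} half)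
            (reverse-bernoulli 0≤x k))) (≤-reflexive (*-identityʳ (ι 2))))
          where
          rearrange : ∀ y → y ≡ ι 2 * (y * ½)
          rearrange = solve 1 (λ y → y := con (ι 2) :* (y :* con ½)) refl

        v^k≤ : v ^ k ≤ q ^ k * ι 2
        v^k≤ = ≤-trans (pow-mono 0≤v v≤ k) (≤-trans (≤-reflexive (^-distrib-* q (1ℚ + x) k))
          (*-monoˡ-≤-nonNeg (q ^ k) {{nonNegative (pow-nonNeg 0≤q k)}} growth))

        s : ℕ
        s = exponent ℕ.* w

        scale≤β : ι 8 * (ι T₀ ^ d * ι T₀ ^ d) ≤ β ^ s
        scale≤β = ≤-trans (≤-reflexive (trans (cong (ι 8 *_) (trans (sym (^-homo-* (ι T₀) d d))
            (trans (cong (λ c → ι T₀ ^ (d ℕ.+ c)) (sym (ℕₚ.+-identityʳ d))) (sym (ι-^ T₀ (2 ℕ.* d))))))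
          (sym (ι-* 8 (T₀ ℕ.^ (2 ℕ.* d))))))
          (≤-trans (ι-mono {8 ℕ.* T₀ ℕ.^ (2 ℕ.* d)} {base ℕ.^ w} scale-bound)
          (≤-trans (≤-reflexive (ι-^ base w))
          (≤-trans (pow-mono (ι-nonNeg base) base≤ w) (≤-reflexive (^-assocʳ β exponent w)))))
          where
          rearrange : ∀ c b d → b * (c * d) ≡ (c * b) * d
          rearrange = solve 3 (λ c b d → b :* (c :* d) := (c :* b) :* d) refl
          -- Powers of `β ≥ 1 + δ` grow at least linearly with slope `δ`, and
          -- `exponent * δ = base * (κ * δ)` with `κ * δ ≥ 1`.
          base≤ : ι base ≤ β ^ exponent
          base≤ = ≤-trans (≤-reflexive (sym (*-identityʳ (ι base))))
            (≤-trans (*-monoˡ-≤-nonNeg (ι base) {{nonNegative (ι-nonNeg base)}} 1≤κδ)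
            (≤-trans (≤-reflexive (trans (rearrange (ι κ) (ι base) δ) (cong (_* δ) (trans (sym (ι-* κ base)) (cong ι (sym exponent≡))))))
                     (Base.pow-linear δ 0<δ 1+δ≤β exponent)))

        -- `y ^ a` is the square of the first moment bound divided by `t ^ (a * d)`: squaring turns
        -- `tri a` into the multiple `k * a` of `a`.
        D y : ℚ
        D = ι T₀ ^ d * ι T₀ ^ d
        y = (ι N ^ 2 * v ^ k) * D

        0≤D : 0ℚ ≤ D
        0≤D = *-nonNeg (pow-nonNeg (ι-nonNeg T₀) d) (pow-nonNeg (ι-nonNeg T₀) d)

        -- With `β * q = 1` the power `β ^ (2 + m)` bounding `N ^ 2` cancels against part of
        -- `q ^ k`. The rest, `4 * 2 * D`, is at most `β ^ s`, which cancels against `q ^ s`.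
        4y≤1 : ι 4 * y ≤ 1ℚ
        4y≤1 = ≤-trans (*-monoˡ-≤-nonNeg (ι 4) (*-monoʳ-≤-nonNeg D {{nonNegative 0≤D}}
            (*-mono (pow-nonNeg (ι-nonNeg N) 2) N²≤ (pow-nonNeg 0≤v k) v^k≤)))
          (≤-trans (≤-reflexive (trans (cong (λ z → ι 4 * ((β ^ (2 ℕ.+ m) * (z * ι 2)) * D)) (^-homo-* q (2 ℕ.+ m) s))
            (rearrange (β ^ (2 ℕ.+ m)) (q ^ (2 ℕ.+ m)) (q ^ s) D)))
          (≤-trans (*-monoʳ-≤-nonNeg (q ^ s) {{nonNegative (pow-nonNeg 0≤q s)}}
            (*-monoˡ-≤-nonNeg (β ^ (2 ℕ.+ m) * q ^ (2 ℕ.+ m))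
              {{nonNegative (*-nonNeg (pow-nonNeg 0≤β (2 ℕ.+ m)) (pow-nonNeg 0≤q (2 ℕ.+ m)))}} scale≤β))
          (≤-reflexive (trans (cong (λ z → (z * β ^ s) * q ^ s) (pow-inverse β q β-inverse (2 ℕ.+ m)))
            (trans (cong (_* q ^ s) (*-identityˡ (β ^ s))) (pow-inverse β q β-inverse s))))))
          where
          rearrange : ∀ b c e D → ι 4 * ((b * ((c * e) * ι 2)) * D) ≡ ((b * c) * (ι 8 * D)) * e
          rearrange = solve 4 (λ b c e D → con (ι 4) :* ((b :* ((c :* e) :* con (ι 2))) :* D)
            := ((b :* c) :* (con (ι 8) :* D)) :* e) refl

        P : ℚ
        P = sparseProb p N a d

        P≤ : P ≤ (ι N ^ a * v ^ tri a) * ι T₀ ^ (a ℕ.* d)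
        P≤ = ≤-trans (≤-reflexive (trans (sym (*-identityʳ P)) (trans (cong (P *_) (sym (pow-inverse t (ι T₀) t-inverse (a ℕ.* d))))
            (sym (*-assoc P (t ^ (a ℕ.* d)) (ι T₀ ^ (a ℕ.* d)))))))
          (*-monoʳ-≤-nonNeg (ι T₀ ^ (a ℕ.* d)) {{nonNegative (pow-nonNeg (ι-nonNeg T₀) (a ℕ.* d))}}
            (sparseProb-bound 0≤p p≤1 0≤t t≤1 N a d))

        square : ((ι N ^ a * v ^ tri a) * ι T₀ ^ (a ℕ.* d)) * ((ι N ^ a * v ^ tri a) * ι T₀ ^ (a ℕ.* d)) ≡ y ^ a
        square = trans (rearrange (ι N ^ a) (v ^ tri a) (ι T₀ ^ (a ℕ.* d)))
          (trans (cong₂ _*_ (cong₂ _*_ N-part v-part) T-part)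
          (trans (cong (_* D ^ a) (sym (^-distrib-* (ι N ^ 2) (v ^ k) a))) (sym (^-distrib-* (ι N ^ 2 * v ^ k) D a))))
          where
          rearrange : ∀ a b c → ((a * b) * c) * ((a * b) * c) ≡ ((a * a) * (b * b)) * (c * c)
          rearrange = solve 3 (λ a b c → ((a :* b) :* c) :* ((a :* b) :* c) := ((a :* a) :* (b :* b)) :* (c :* c)) refl
          N-part : ι N ^ a * ι N ^ a ≡ (ι N ^ 2) ^ a
          N-part = trans (sym (^-homo-* (ι N) a a))
            (trans (cong (λ c → ι N ^ (a ℕ.+ c)) (sym (ℕₚ.+-identityʳ a))) (sym (^-assocʳ (ι N) 2 a)))
          v-part : v ^ tri a * v ^ tri a ≡ (v ^ k) ^ a
          v-part = trans (sym (^-homo-* v (tri a) (tri a))) (trans (cong (v ^_) (tri-double k)) (sym (^-assocʳ v k a)))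
          T-part : ι T₀ ^ (a ℕ.* d) * ι T₀ ^ (a ℕ.* d) ≡ D ^ a
          T-part = trans (cong (λ c → ι T₀ ^ c * ι T₀ ^ c) (ℕₚ.*-comm a d))
            (trans (cong (λ c → c * c) (sym (^-assocʳ (ι T₀) d a))) (sym (^-distrib-* (ι T₀ ^ d) (ι T₀ ^ d) a)))

        0≤P : 0ℚ ≤ P
        0≤P = sumℚ-nonNeg (weightℚ-nonNeg 0≤p p≤1) (filterᵇ (does ∘ sparse? a d) (allGraphs N))

      -- Left in squared form, which avoids roots; the factor `4 ^ a` supplies the decay.
      sparseProb-small : (sparseProb p N (size m w) d * sparseProb p N (size m w) d) * ι 4 ^ size m w ≤ 1ℚ
      sparseProb-small = ≤-trans
        (*-monoʳ-≤-nonNeg (ι 4 ^ a) {{nonNegative (pow-nonNeg (ι-nonNeg 4) a)}} (*-mono 0≤P P≤ 0≤P P≤))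
        (≤-trans (≤-reflexive (trans (cong (_* ι 4 ^ a) square) (trans (*-comm (y ^ a) (ι 4 ^ a)) (sym (^-distrib-* (ι 4) y a)))))
        (≤-trans (pow-mono (*-nonNeg (ι-nonNeg 4) 0≤y) 4y≤1 a) (≤-reflexive (1^ a))))
        where
        0≤y : 0ℚ ≤ y
        0≤y = *-nonNeg (*-nonNeg (pow-nonNeg (ι-nonNeg N) 2) (pow-nonNeg 0≤v k)) 0≤D

-- The root `w` of `m` measures the surplus in the set size: it is unbounded, so it beats all
-- constants, yet of smaller order than `m`, so the leading term is unaffected.
sqrt : ∀ m → ∃[ w ] w ℕ.* w ℕ.≤ m × m ℕ.< suc w ℕ.* suc w
sqrt zero    = 0 , ℕ.z≤n , ℕ.s≤s ℕ.z≤n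
sqrt (suc m) with sqrt m
... | w , lo , up with suc m ℕ.<? suc w ℕ.* suc w
...   | yes lt = w , ℕₚ.≤-trans lo (ℕₚ.n≤1+n m) , lt
...   | no ≮   = suc w , ℕₚ.≮⇒≥ ≮ ,
                 ℕₚ.≤-<-trans up (ℕₚ.*-mono-< (ℕₚ.n<1+n (suc w)) (ℕₚ.n<1+n (suc w)))

ι-cancel-≤ : ∀ m n → ι m ≤ ι n → m ℕ.≤ n
ι-cancel-≤ m n le with m ℕ.≤? n
... | yes m≤n = m≤n
... | no  m≰n = ⊥-elim (<-irrefl refl (<-≤-trans (subst₂ _<_ (+-identityˡ (ι n)) (sym (ι-+ 1 n)) (+-monoˡ-< (ι n) 0<1))
  (≤-trans (ι-mono {suc n} {m} (ℕₚ.≰⇒> m≰n)) le)))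

reciprocal-bound : ∀ δ → 0ℚ < δ → ∃[ K ] ∀ {n} → K ℕ.≤ n → 1ℚ ≤ ι n * δ
reciprocal-bound δ 0<δ = proj₁ arch , λ {n} K≤n →
  ≤-trans (≤-reflexive (sym (inv-inverseˡ δ 0<δ)))
    (*-monoʳ-≤-nonNeg δ {{nonNegative (<⇒≤ 0<δ)}} (≤-trans (proj₂ arch) (ι-mono {proj₁ arch} {n} K≤n)))
  where
  arch : ∃[ K ] inv δ 0<δ ≤ ι K
  arch = archimedean (inv δ 0<δ)

-- If `P` exceeded `η`, then `P ^ 2 * Q` would exceed `η ^ 2 * Q ≥ 1`.
square-cancel : ∀ {η P Q} → 0ℚ < η → 0ℚ < Q → 1ℚ ≤ Q * (η * η) → (P * P) * Q ≤ 1ℚ → P ≤ η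
square-cancel {η} {P} {Q} 0<η 0<Q big small with P ≤? η
... | yes P≤η = P≤η
... | no  P≰η = ⊥-elim (<-irrefl refl (≤-<-trans big (<-≤-trans (<-≤-trans step₁ step₂) small)))
  where
  open +-*-Solver
  η<P : η < P
  η<P = ≰⇒> P≰η
  0<ηQ : 0ℚ < η * Q
  0<ηQ = *-pos 0<η 0<Q
  rearrange : ∀ a b q → a * (b * q) ≡ q * (a * b)
  rearrange = solve 3 (λ a b q → a :* (b :* q) := q :* (a :* b)) refl
  step₁ : Q * (η * η) < P * (η * Q)
  step₁ = ≤-<-trans (≤-reflexive (sym (rearrange η η Q))) (*-monoˡ-<-pos (η * Q) {{positive 0<ηQ}} η<P)
  step₂ : P * (η * Q) ≤ (P * P) * Q
  step₂ = ≤-trans (*-monoˡ-≤-nonNeg P {{nonNegative (<⇒≤ (<-trans 0<η η<P))}}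
                    (*-monoʳ-≤-nonNeg Q {{nonNegative (<⇒≤ 0<Q)}} (<⇒≤ η<P)))
    (≤-reflexive (sym (*-assoc P P Q)))

-- Passage to a real edge probability

module Asymptotics (d : ℕ) (p : ℝ) (0<p : 0ℝ <ℝ p) (p<1 : p <ℝ 1ℝ) where

  b : ℝ
  b = 1/ℝ (1ℝ -ℝ p) (x<1⇒0<1-x {p} p<1)

  1<b : 1ℝ <ℝ b
  1<b = 1<1/[1-x] {p} 0<p p<1

  δ ε : ℚ
  δ = proj₁ 0<p
  ε = proj₁ p<1

  0<δ : 0ℚ < δ
  0<δ = proj₁ (proj₂ 0<p)

  0<ε : 0ℚ < ε
  0<ε = proj₁ (proj₂ p<1)

  -- One integer above both `1 / δ` and `1 / ε`. Since `1 - p ≥ ε` eventually, it also bounds the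
  -- terms of `b` and the ratio of `p` to `1 - p`.
  κ : ℕ
  κ = suc (proj₁ (reciprocal-bound δ 0<δ) ℕ.+ proj₁ (reciprocal-bound ε 0<ε))

  1≤κδ : 1ℚ ≤ ι κ * δ
  1≤κδ = proj₂ (reciprocal-bound δ 0<δ) {κ} (ℕₚ.≤-trans (ℕₚ.m≤m+n _ _) (ℕₚ.n≤1+n _))

  1≤κε : 1ℚ ≤ ι κ * ε
  1≤κε = proj₂ (reciprocal-bound ε 0<ε) {κ} (ℕₚ.≤-trans (ℕₚ.m≤n+m _ (proj₁ (reciprocal-bound δ 0<δ))) (ℕₚ.n≤1+n _))

  open Estimate κ d (ℕ.s≤s ℕ.z≤n)

  -- The bounds on `p` and `b` hold for their terms from some index on only; this collects what the
  -- rational estimate needs at index `i`.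
  record Regular (i : ℕ) : Set where
    field
      0≤p       : 0ℚ ≤ seq p i
      p≤1       : seq p i ≤ 1ℚ
      ε≤1-p     : ε ≤ 1ℚ - seq p i
      1+δ≤β     : 1ℚ + δ ≤ seq b i
      β-inverse : seq b i * (1ℚ - seq p i) ≡ 1ℚ

  regular : Eventually Regular
  regular = Eventually-zip (λ {i} → make i) (proj₂ (proj₂ 0<p)) (Eventually-zip _,_ (proj₂ (proj₂ p<1)) (proj₂ (proj₂ 1<b)))
    where
    open +-*-Solver
    rearrange : ∀ a e → (a + e) - a ≡ e
    rearrange = solve 2 (λ a e → (a :+ e) :- a := e) refl
    make : ∀ i → 0ℚ + δ ≤ seq p i → (seq p i + ε ≤ 1ℚ) × (1ℚ + δ ≤ seq b i) → Regular i
    make i δ≤p (p+ε≤1 , 1+δ≤β) = record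
      { 0≤p       = ≤-trans (<⇒≤ 0<δ) (≤-trans (≤-reflexive (sym (+-identityˡ δ))) δ≤p)
      ; p≤1       = ≤-trans (p≤p+q (seq p i) (<⇒≤ 0<ε)) p+ε≤1
      ; ε≤1-p     = ε≤
      ; 1+δ≤β     = 1+δ≤β
      -- Since `ε ≤ 1 - p` at this index, the truncation in `1/ℝ` is inactive.
      ; β-inverse = trans (cong (seq b i *_) (sym (p≤q⇒p⊔q≡q ε≤))) (Reciprocal.recip-inverse ε 0<ε (1ℚ - seq p i))
      }
      where
      ε≤ : ε ≤ 1ℚ - seq p i
      ε≤ = ≤-trans (≤-reflexive (sym (rearrange (seq p i) ε))) (+-monoˡ-≤ (- seq p i) p+ε≤1)

  module _ {i} (reg : Regular i) where
    open Regular reg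

    1≤κ[1-p] : 1ℚ ≤ ι κ * (1ℚ - seq p i)
    1≤κ[1-p] = ≤-trans 1≤κε (*-mono (ι-nonNeg κ) ≤-refl (<⇒≤ 0<ε) ε≤1-p)

    0≤β : 0ℚ ≤ seq b i
    0≤β = Base.0≤β δ 0<δ 1+δ≤β

    β≤κ : seq b i ≤ ι κ
    β≤κ = ≤-trans (≤-reflexive (sym (*-identityʳ (seq b i))))
      (≤-trans (*-monoˡ-≤-nonNeg (seq b i) {{nonNegative 0≤β}} 1≤κ[1-p])
      (≤-reflexive (trans (rearrange (seq b i) (ι κ) (1ℚ - seq p i)) (trans (cong (ι κ *_) β-inverse) (*-identityʳ (ι κ))))))
      where
      open +-*-Solver
      rearrange : ∀ a c q → a * (c * q) ≡ c * (a * q)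
      rearrange = solve 3 (λ a c q → a :* (c :* q) := c :* (a :* q)) refl

  -- twiceLog n is m with b ^ m ≤ n ^ 2 ≤ b ^ (m + 2); the value at n = 0 is junk.
  twiceLog root order : ℕ → ℕ
  twiceLog zero    = 0
  twiceLog (suc n) = Log.num b 1<b n 1
  root n  = proj₁ (sqrt (twiceLog n))
  order n = size (twiceLog n) (root n)

  n²≤ : ∀ n → Eventually λ i → ι n ^ 2 ≤ seq b i ^ (2 ℕ.+ twiceLog n)
  n²≤ zero    = Eventually-map (λ reg → pow-nonNeg (0≤β reg) 2) regular
  n²≤ (suc n) = proj₂ (proj₂ (bracket b 1<b n 2))

  -- If `root n < W`, then `twiceLog n` is below `W ^ 2`, so `n ≤ n ^ 2 ≤ κ ^ (2 + W ^ 2)` because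
  -- the terms of `b` are at most `κ`.
  root-unbounded : ∀ W → Eventually λ n → W ℕ.≤ root n
  root-unbounded W = suc (κ ℕ.^ (2 ℕ.+ W ℕ.* W)) , λ n n≥ → case W ℕ.≤? root n of λ where
      (yes W≤) → W≤
      (no  W≰) → ⊥-elim (ℕₚ.<-irrefl refl (ℕₚ.<-≤-trans n≥ (bounded-n n (ℕₚ.≰⇒> W≰))))
    where
    bounded-n : ∀ n → root n ℕ.< W → n ℕ.≤ κ ℕ.^ (2 ℕ.+ W ℕ.* W)
    bounded-n n root<W = case Eventually-zip _,_ regular (n²≤ n) of λ (M , h) → case h M ℕₚ.≤-refl of λ (reg , le) →
      ℕₚ.≤-trans (n≤n^w n {2} (ℕ.s≤s ℕ.z≤n)) (ℕₚ.≤-trans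
        (ι-cancel-≤ (n ℕ.^ 2) (κ ℕ.^ (2 ℕ.+ twiceLog n)) (≤-trans (≤-reflexive (ι-^ n 2))
          (≤-trans le (≤-trans (pow-mono (0≤β reg) (β≤κ reg) (2 ℕ.+ twiceLog n))
                               (≤-reflexive (sym (ι-^ κ (2 ℕ.+ twiceLog n))))))))
        (ℕₚ.^-monoʳ-≤ κ (ℕ.s≤s (ℕ.s≤s (ℕₚ.≤-trans (ℕₚ.<⇒≤ (proj₂ (proj₂ (sqrt (twiceLog n))))) (ℕₚ.*-mono-≤ root<W root<W))))))

  -- The threshold for the index `i` may depend on `n`: for each large `n` the real probability is
  -- controlled through its late terms.
  sparse-unlikely : ∀ {η} → 0ℚ < η → Eventually λ n → Eventually λ i →
                    Regular i × sparseProb (seq p i) n (order n) d ≤ η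
  sparse-unlikely {η} 0<η = Eventually-map (λ {n} → bound n) (root-unbounded W)
    where
    K W : ℕ
    K = proj₁ (reciprocal-bound (η * η) (*-pos 0<η 0<η))
    -- Large enough for the hypothesis `exponent ≤ w` and for `4 ^ a ≥ K`, which gives
    -- `4 ^ a * η ^ 2 ≥ 1`.
    W = suc (exponent ℕ.+ K)
    bound : ∀ n → W ℕ.≤ root n → Eventually λ i → Regular i × sparseProb (seq p i) n (order n) d ≤ η
    bound n W≤ = Eventually-zip (λ {i} reg n² → let open Regular reg in reg ,
        square-cancel 0<η (<-≤-trans 0<1 (1≤pow (ι-mono {1} {4} (ℕ.s≤s ℕ.z≤n)) a)) large
          (sparseProb-small (twiceLog n) w (ℕₚ.≤-trans (ℕₚ.m≤m+n exponent K) (ℕₚ.≤-trans (ℕₚ.n≤1+n _) W≤)) 1≤w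
            (proj₂ (proj₂ (sqrt (twiceLog n)))) {N = n} 0≤p p≤1 0<δ (≤-trans p≤1 (1≤κ[1-p] reg)) 1≤κδ 1+δ≤β β-inverse n²))
      regular (n²≤ n)
      where
      w a : ℕ
      w = root n
      a = order n
      1≤w : 1 ℕ.≤ w
      1≤w = ℕₚ.≤-trans (ℕ.s≤s ℕ.z≤n) W≤
      K≤4^a : K ℕ.≤ 4 ℕ.^ a
      K≤4^a = ℕₚ.≤-trans (ℕₚ.≤-trans (ℕₚ.m≤n+m K exponent) (ℕₚ.≤-trans (ℕₚ.n≤1+n _) W≤))
        (ℕₚ.≤-trans (ℕₚ.m≤m*n w w {{ℕ.>-nonZero 1≤w}}) (ℕₚ.≤-trans (proj₁ (proj₂ (sqrt (twiceLog n))))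
        (ℕₚ.≤-trans (ℕₚ.m≤m+n (twiceLog n) (exponent ℕ.* w)) (ℕₚ.≤-trans (ℕₚ.m≤n+m _ 4)
        (ℕₚ.≤-trans (suc≤2^ a) (ℕₚ.^-monoˡ-≤ a (ℕₚ.m≤m+n 2 2)))))))
      large : 1ℚ ≤ ι 4 ^ a * (η * η)
      large = ≤-trans (proj₂ (reciprocal-bound (η * η) (*-pos 0<η 0<η)) {4 ℕ.^ a} K≤4^a)
        (≤-reflexive (cong (_* (η * η)) (ι-^ 4 a)))

  -- Empty when the root is 0, which concerns finitely many `n`; the event thus provides the bound
  -- `1 ≤ root n` needed to estimate `order n`.
  event : ∀ n → ℕ → Graph n → Bool
  event n zero    = λ _ → false
  event n (suc _) = not ∘ does ∘ sparse? (order n) d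

  -- The term of the probability is 1 minus that of a sparse set, which lies between 0 and `η` at
  -- late indices.
  ℙ-event : (λ n → ℙ {n} p (event n (root n))) ⟶ 1ℝ
  ℙ-event ζ (η , 0<η , η≤ζ) =
    Eventually-zip (λ {n} → close n (root n)) (root-unbounded 1) (sparse-unlikely 0<η)
    where
    close : ∀ n w → 1 ℕ.≤ w → (Eventually λ i → Regular i × sparseProb (seq p i) n (order n) d ≤ η) →
            (ℙ {n} p (event n w) ≤ℝ 1ℝ +ℝ ζ) × (1ℝ ≤ℝ ℙ {n} p (event n w) +ℝ ζ)
    close n (suc w) _ rare =
      (λ θ 0<θ → Eventually-zip (λ {i} (reg , _) η≤ζᵢ → upper i reg (seq ζ i) θ (0≤ζ (seq ζ i) η≤ζᵢ) (<⇒≤ 0<θ)) rare η≤ζ) ,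
      (λ θ 0<θ → Eventually-zip (λ {i} (_ , P≤η) η≤ζᵢ → lower i (seq ζ i) θ P≤η η≤ζᵢ (<⇒≤ 0<θ)) rare η≤ζ)
      where
      0≤ζ : ∀ z → 0ℚ + η ≤ z → 0ℚ ≤ z
      0≤ζ z = ≤-trans (≤-trans (<⇒≤ 0<η) (≤-reflexive (sym (+-identityˡ η))))
      total : ∀ i → sparseProb (seq p i) n (order n) d + seq (ℙ {n} p (event n (suc w))) i ≡ 1ℚ
      total = seq-ℙ-dense {n} p (order n) d
      upper : ∀ i → Regular i → ∀ z θ → 0ℚ ≤ z → 0ℚ ≤ θ → seq (ℙ {n} p (event n (suc w))) i ≤ (1ℚ + z) + θ
      upper i reg z θ 0≤z 0≤θ = ≤-trans
        (≤-trans (≤-reflexive (sym (+-identityˡ P′))) (+-monoˡ-≤ P′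
          (sumℚ-nonNeg (weightℚ-nonNeg 0≤p p≤1) (filterᵇ (does ∘ sparse? (order n) d) (allGraphs n)))))
        (≤-trans (≤-reflexive (total i)) (≤-trans (p≤p+q 1ℚ 0≤z) (p≤p+q (1ℚ + z) 0≤θ)))
        where
        open Regular reg
        P′ : ℚ
        P′ = seq (ℙ {n} p (event n (suc w))) i
      lower : ∀ i z θ → sparseProb (seq p i) n (order n) d ≤ η → 0ℚ + η ≤ z → 0ℚ ≤ θ →
              1ℚ ≤ (seq (ℙ {n} p (event n (suc w))) i + z) + θ
      lower i z θ P≤η η≤z 0≤θ = ≤-trans (≤-reflexive (sym (total i)))
        (≤-trans (+-monoˡ-≤ P′ (≤-trans P≤η (≤-trans (≤-reflexive (sym (+-identityˡ η))) η≤z)))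
        (≤-trans (≤-reflexive (+-comm z P′)) (p≤p+q (P′ + z) 0≤θ)))
        where
        P′ : ℚ
        P′ = seq (ℙ {n} p (event n (suc w))) i

  -- The error term and the comparison with the logarithm

  overhead : ℕ
  overhead = 2 ℕ.* (d ℕ.* (3 ℕ.+ exponent))

  0<1+root : ∀ n → 0ℚ < ι (suc (root n))
  0<1+root n = <-≤-trans 0<1 (ι-mono {1} {suc (root n)} (ℕ.s≤s ℕ.z≤n))

  -- The surplus of `order n * d` over `d * m` is of order `w`, and `m ≥ w ^ 2`, so the relative
  -- error is of order `1 / w`. The divisor `w + 1` is positive for every `n`.
  oℚ : ℕ → ℚ
  oℚ n = ι overhead * inv (ι (suc (root n))) (0<1+root n)

  0≤oℚ : ∀ n → 0ℚ ≤ oℚ n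
  0≤oℚ n = *-nonNeg (ι-nonNeg overhead) (<⇒≤ (inv-pos (ι (suc (root n))) (0<1+root n)))

  oℚ-cancel : ∀ n → oℚ n * ι (suc (root n)) ≡ ι overhead
  oℚ-cancel n = inv-cancel (ι (suc (root n))) (0<1+root n) (ι overhead)

  cancel-1+root : ∀ n {x y} → x * ι (suc (root n)) ≤ y * ι (suc (root n)) → x ≤ y
  cancel-1+root n = *-cancelʳ-≤-pos (ι (suc (root n))) {{positive (0<1+root n)}}

  o : ℕ → ℝ
  o n = fromℚ (oℚ n)

  o⟶0 : o ⟶ 0ℝ
  o⟶0 ζ (η , 0<η , η≤ζ) = Eventually-map (λ {n} K≤ →
      (λ θ 0<θ → Eventually-map (λ {i} η≤ζᵢ → ≤-trans (≤-trans (small n K≤) (≤-trans (≤-reflexive (sym (+-identityˡ η))) η≤ζᵢ))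
        (≤-trans (≤-reflexive (sym (+-identityˡ (seq ζ i)))) (p≤p+q (0ℚ + seq ζ i) (<⇒≤ 0<θ)))) η≤ζ) ,
      (λ θ 0<θ → Eventually-map (λ {i} η≤ζᵢ → ≤-trans (≤-trans (0≤oℚ n) (p≤p+q (oℚ n) (≤-trans (<⇒≤ 0<η)
        (≤-trans (≤-reflexive (sym (+-identityˡ η))) η≤ζᵢ)))) (p≤p+q (oℚ n + seq ζ i) (<⇒≤ 0<θ))) η≤ζ))
    (root-unbounded (overhead ℕ.* K))
    where
    open +-*-Solver
    K : ℕ
    K = proj₁ (reciprocal-bound η 0<η)
    rearrange : ∀ a b c → a * (b * c) ≡ c * (a * b)
    rearrange = solve 3 (λ a b c → a :* (b :* c) := c :* (a :* b)) refl
    small : ∀ n → overhead ℕ.* K ℕ.≤ root n → oℚ n ≤ η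
    small n K≤ = cancel-1+root n (≤-trans (≤-reflexive (trans (oℚ-cancel n) (sym (*-identityʳ (ι overhead)))))
      (≤-trans (*-monoˡ-≤-nonNeg (ι overhead) {{nonNegative (ι-nonNeg overhead)}} (proj₂ (reciprocal-bound η 0<η) {K} ℕₚ.≤-refl))
      (≤-trans (≤-reflexive (trans (rearrange (ι overhead) (ι K) η) (cong (η *_) (sym (ι-* overhead K)))))
      (*-monoˡ-≤-nonNeg η {{nonNegative (<⇒≤ 0<η)}} (ι-mono {overhead ℕ.* K} {suc (root n)} (ℕₚ.≤-trans K≤ (ℕₚ.n≤1+n _)))))))

  -- The surplus is `(3 + exponent * w) * d`. Multiplied by `w + 1 ≤ 2 w` it is at most
  -- `overhead * w ^ 2`, hence at most `overhead * m`.
  order≤ : ∀ n → 1 ℕ.≤ root n → ι (order n) * ι d ≤ (ι d + oℚ n) * ι (twiceLog n)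
  order≤ n 1≤w = ≤-trans (≤-reflexive split) (≤-trans (+-monoʳ-≤ (ι d * ι m) excess)
      (≤-reflexive (sym (*-distribʳ-+ (ι m) (ι d) (oℚ n)))))
    where
    m w s : ℕ
    m = twiceLog n
    w = root n
    s = 3 ℕ.+ exponent ℕ.* w
    split : ι (order n) * ι d ≡ ι d * ι m + ι (s ℕ.* d)
    split = trans (sym (ι-* (order n) d)) (trans (cong ι (rearrange m (exponent ℕ.* w) d))
      (trans (ι-+ (d ℕ.* m) (s ℕ.* d)) (cong (_+ ι (s ℕ.* d)) (ι-* d m))))
      where
      open ℕ-Solver.+-*-Solver
      rearrange : ∀ m e d → (3 ℕ.+ (m ℕ.+ e)) ℕ.* d ≡ d ℕ.* m ℕ.+ (3 ℕ.+ e) ℕ.* d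
      rearrange = solve 3 (λ m e d → (con 3 :+ (m :+ e)) :* d := d :* m :+ (con 3 :+ e) :* d) refl
    excess-ℕ : (s ℕ.* d) ℕ.* suc w ℕ.≤ overhead ℕ.* m
    excess-ℕ = ℕₚ.≤-trans (ℕₚ.*-mono-≤ (ℕₚ.*-monoˡ-≤ d s≤) 1+w≤)
      (ℕₚ.≤-trans (ℕₚ.≤-reflexive (rearrange (3 ℕ.+ exponent) w d))
                  (ℕₚ.*-monoʳ-≤ overhead (proj₁ (proj₂ (sqrt m)))))
      where
      open ℕ-Solver.+-*-Solver
      s≤ : s ℕ.≤ (3 ℕ.+ exponent) ℕ.* w
      s≤ = ℕₚ.≤-trans (ℕₚ.+-monoˡ-≤ (exponent ℕ.* w) (ℕₚ.*-monoʳ-≤ 3 1≤w))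
        (ℕₚ.≤-reflexive (sym (ℕₚ.*-distribʳ-+ w 3 exponent)))
      1+w≤ : suc w ℕ.≤ 2 ℕ.* w
      1+w≤ = ℕₚ.+-mono-≤ 1≤w (ℕₚ.≤-reflexive (sym (ℕₚ.+-identityʳ w)))
      rearrange : ∀ c w d → ((c ℕ.* w) ℕ.* d) ℕ.* (2 ℕ.* w) ≡ (2 ℕ.* (d ℕ.* c)) ℕ.* (w ℕ.* w)
      rearrange = solve 3 (λ c w d → ((c :* w) :* d) :* (con 2 :* w) := (con 2 :* (d :* c)) :* (w :* w)) refl
    excess : ι (s ℕ.* d) ≤ oℚ n * ι m
    excess = cancel-1+root n (≤-trans (≤-reflexive (sym (ι-* (s ℕ.* d) (suc w))))
      (≤-trans (ι-mono {(s ℕ.* d) ℕ.* suc w} {overhead ℕ.* m} excess-ℕ)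
      (≤-reflexive (trans (ι-* overhead m) (trans (cong (_* ι m) (sym (oℚ-cancel n))) (rearrange (oℚ n) (ι (suc w)) (ι m)))))))
      where
      open +-*-Solver
      rearrange : ∀ a b c → (a * b) * c ≡ (a * c) * b
      rearrange = solve 3 (λ a b c → (a :* b) :* c := (a :* c) :* b) refl

  final : ∀ n → 1 ℕ.≤ root n → ∀ S → n ℕ.* d ℕ.≤ (S ℕ.+ S) ℕ.+ order n ℕ.* d → ∀ R → R ≡ suc d →
          fromℕ S ≥ℝ fromℚ ½ *ℝ (fromℕ R -ℝ 1ℝ) *ℝ fromℕ n -ℝ ((fromℕ R -ℝ 1ℝ) +ℝ o n) *ℝ log b 1<b n
  final (suc n) 1≤w S le R refl θ 0<θ = Eventually-map (λ {j} → bound j) (2/-small ζ 0<ζ)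
    where
    open +-*-Solver
    D O M C : ℚ
    D = ι d
    O = oℚ (suc n)
    M = ι (twiceLog (suc n))
    C = D + O
    0≤C : 0ℚ ≤ C
    0≤C = ≤-trans (ι-nonNeg d) (p≤p+q D (0≤oℚ (suc n)))
    0<C+1 : 0ℚ < C + 1ℚ
    0<C+1 = <-≤-trans 0<1 (≤-trans (≤-reflexive (sym (+-identityˡ 1ℚ))) (+-monoˡ-≤ 1ℚ 0≤C))
    -- Replacing term 1 of the logarithm by term `j` costs at most `ζ`, which enters with the factor
    -- `C`. The added 1 keeps the divisor positive.
    ζ : ℚ
    ζ = θ * inv (C + 1ℚ) 0<C+1
    0<ζ : 0ℚ < ζ
    0<ζ = *-pos 0<θ (inv-pos (C + 1ℚ) 0<C+1)
    Cζ≤θ : C * ζ ≤ θ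
    Cζ≤θ = ≤-trans (*-monoʳ-≤-nonNeg ζ {{nonNegative (<⇒≤ 0<ζ)}} (p≤p+q C (<⇒≤ 0<1)))
      (≤-reflexive (trans (*-comm (C + 1ℚ) ζ) (inv-cancel (C + 1ℚ) 0<C+1 θ)))
    degree : D ≡ ι (suc d) - 1ℚ
    degree = trans (rearrange D) (cong (_- 1ℚ) (sym (ι-+ 1 d)))
      where
      rearrange : ∀ x → x ≡ (1ℚ + x) - 1ℚ
      rearrange = solve 1 (λ x → x := (con 1ℚ :+ x) :- con 1ℚ) refl
    A : ℕ → ℚ
    A = Log.approx b 1<b n
    -- Term 1 of the logarithm has denominator 2 and numerator `twiceLog`, so its double is `M`.
    M≤ : M ≤ A 1 + A 1
    M≤ = ≤-trans (/-≤ m 0 (m ℕ.+ m) 1 (ℕₚ.≤-reflexive (rearrange m))) (≤-reflexive (/-+ m m 1))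
      where
      m : ℕ
      m = twiceLog (suc n)
      rearrange : ∀ m → m ℕ.* 2 ≡ (m ℕ.+ m) ℕ.* 1
      rearrange = N.solve 1 (λ m → m N.:* N.con 2 N.:= (m N.:+ m) N.:* N.con 1) refl
        where module N = ℕ-Solver.+-*-Solver
    nD≤ : ι (suc n) * D ≤ (ι S + ι S) + C * (A 1 + A 1)
    nD≤ = ≤-trans (≤-reflexive (sym (ι-* (suc n) d))) (≤-trans (ι-mono {suc n ℕ.* d} {(S ℕ.+ S) ℕ.+ order (suc n) ℕ.* d} le)
      (≤-trans (≤-reflexive (trans (ι-+ (S ℕ.+ S) (order (suc n) ℕ.* d)) (cong₂ _+_ (ι-+ S S) (ι-* (order (suc n)) d))))
      (+-monoʳ-≤ (ι S + ι S) (≤-trans (order≤ (suc n) 1≤w) (*-monoˡ-≤-nonNeg C {{nonNegative 0≤C}} M≤)))))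
    bound : ∀ j → ℤ.+ 2 / suc j ≤ ζ →
            ½ * (ι (suc d) - 1ℚ) * ι (suc n) - ((ι (suc d) - 1ℚ) + O) * A j ≤ ι S + θ
    bound j 2/j≤ζ = subst (λ z → ½ * z * ι (suc n) - (z + O) * A j ≤ ι S + θ) degree
      (≤-trans (≤-reflexive (rearrange₁ D (ι (suc n)) (C * A j)))
      (≤-trans (+-monoˡ-≤ (- (C * A j)) (*-monoˡ-≤-nonNeg ½ (≤-trans nD≤
        (+-monoʳ-≤ (ι S + ι S) (*-monoˡ-≤-nonNeg C {{nonNegative 0≤C}} (+-mono-≤ A1≤ A1≤))))))
      (≤-trans (≤-reflexive (rearrange₂ (ι S) C (A j) ζ)) (+-monoʳ-≤ (ι S) Cζ≤θ))))
      where
      A1≤ : A 1 ≤ A j + ζ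
      A1≤ = ≤-trans (Log.approx-≤ b 1<b n 1 j) (+-monoʳ-≤ (A j) 2/j≤ζ)
      rearrange₁ : ∀ D n x → ½ * D * n - x ≡ ½ * (n * D) - x
      rearrange₁ = solve 3 (λ D n x → con ½ :* D :* n :- x := con ½ :* (n :* D) :- x) refl
      rearrange₂ : ∀ S C A z → ½ * ((S + S) + C * ((A + z) + (A + z))) - C * A ≡ S + C * z
      rearrange₂ = solve 4 (λ S C A z → con ½ :* ((S :+ S) :+ C :* ((A :+ z) :+ (A :+ z))) :- C :* A := S :+ C :* z) refl

-- Combination of the deterministic and the probabilistic bound

corollary3p3 : ∀ {k} (F : Graph k) → HasEdge F →
    (p : ℝ) (0<p : 0ℝ <ℝ p) (p<1 : p <ℝ 1ℝ) →
    Σ (ℕ → ℝ) λ o → (o ⟶ 0ℝ) ×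
    WithHighProbability p (λ n G →
    fromℕ (sat G F) ≥ℝ
    fromℚ ½ *ℝ (fromℕ (r F) -ℝ 1ℝ) *ℝ fromℕ n
    -ℝ ((fromℕ (r F) -ℝ 1ℝ) +ℝ o n) *ℝ log₁/[1- p ] 0<p p<1 n)
corollary3p3 F hasEdge p 0<p p<1 =
  -- The root is passed together with an equation, so that matching it with `suc w` discards the
  -- empty event and yields `1 ≤ root n`.
  o , o⟶0 , (λ n → event n (root n)) , (λ n G → holds n G (root n) refl) , ℙ-event
  where
  d : ℕ
  d = ℕ.pred (r F)
  r≡ : r F ≡ suc d
  r≡ = sym (ℕₚ.suc-pred (r F) {{ℕ.>-nonZero (1≤r F hasEdge)}})
  open Asymptotics d p 0<p p<1
  dense : ∀ {n} (G : Graph n) → T (not (does (sparse? (order n) d G))) → ¬ Sparse (order n) d G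
  dense {n} G h with sparse? (order n) d G
  ... | no ¬sparse = ¬sparse
  holds : ∀ n G w → root n ≡ w → T (event n w G) →
          fromℕ (sat G F) ≥ℝ fromℚ ½ *ℝ (fromℕ (r F) -ℝ 1ℝ) *ℝ fromℕ n
            -ℝ ((fromℕ (r F) -ℝ 1ℝ) +ℝ o n) *ℝ log₁/[1- p ] 0<p p<1 n
  holds n G (suc w) eq h = final n (subst (1 ℕ.≤_) (sym eq) (ℕ.s≤s ℕ.z≤n)) (sat G F)
    (sat-bound F G (order n) d r≡ (dense G h)) (r F) r≡
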